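{- Let $p$ be a prime with $p\equiv 1\pmod 4$ and let $m,\alpha,\beta\ge 1$ be integers with $2\nmid\alpha$. (i) If $\bar a_{2^m\alpha}(3p)\equiv 0\pmod 2$, then for all integers $n,k\ge 0$ with $p\nmid(4n+3)$, $$\bar a_{2^m\alpha}\left(4p^{2k+1}n+3p^{2k+1}\right)\equiv 0\pmod{2^{m+3}}.$$ (ii) If $\bar a_{2\beta+1}(3p)\equiv 0\pmod 2$, then for all integers $n,k\ge 0$ with $p\nmid(4n+3)$, $$\bar a_{2\beta+1}\left(4p^{2k+1}n+3p^{2k+1}\right)\equiv 0\pmod{16}.$$
   Context: For integers $\ell\ge1$ write $f_\ell=\prod_{j\ge 1}(1-q^{\ell j})$. For a positive integer $s$, $\bar a_s(n)$ denotes the number of partitions of $n$ in which each odd part occurs in one of $s$ colors and the first occurrence of each part (parts of the same size but different colors being distinct) may be overlined. Equivalently, $$\sum_{n\ge0}\bar a_s(n)q^n=\frac{f_2^{3s-2}}{f_1^{2s}f_4^{s-1}}.$$ -}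

module Defs where

open import Data.Bool using (if_then_else_)
open import Data.Empty using (⊥)
open import Data.Fin using (Fin)
open import Data.List using (List; []; _∷_; map; concatMap; cartesianProductWith; applyUpTo; upTo; allFin; filter; length; _++_)
open import Data.List.Membership.Propositional using (_∈_)
open import Data.List.Membership.Propositional.Properties using (∈-++⁺ˡ; ∈-++⁺ʳ; ∈-++⁻; ∈-map⁺; ∈-map⁻; ∈-upTo⁺; ∈-cartesianProductWith⁺; ∈-filter⁺; ∈-filter⁻)
open import Data.List.Relation.Unary.All using (All; []; _∷_)
open import Data.List.Relation.Unary.All.Properties using (concat⁺; map⁺; applyUpTo⁺₂)
import Data.List.Relation.Unary.All as All
import Data.List.Relation.Unary.AllPairs as AllPairs
open import Data.List.Relation.Unary.Any using (here; there)
open import Data.List.Relation.Unary.Unique.Propositional using (Unique)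
import Data.List.Relation.Unary.Unique.Propositional.Properties as Unique
open import Data.Nat using (ℕ; suc; _+_; _*_; _≤_; _≟_; _≡ᵇ_; NonZero)
open import Data.Nat.DivMod using (_%_)
open import Data.Nat.Properties using (≤-trans; ≤-reflexive; m≤m+n; m≤n+m; m≤m*n)
open import Data.Product using (Σ; _×_; _,_; proj₁; proj₂)
open import Data.Sum using (inj₁; inj₂)
open import Function using (_⇔_; mk⇔; const)
open import Relation.Binary.PropositionalEquality using (_≡_; _≢_; refl)

colours : ℕ → ℕ → ℕ
colours s j = if j % 2 ≡ᵇ 1 then s else 1

Part : ℕ → Set
Part s = Σ ℕ λ j → Fin (colours s j)

size : ∀ {s} → Part s → ℕ
size = proj₁

parts : ∀ s → ℕ → List (Part s)
parts s n = concatMap (λ j → map (j ,_) (allFin (colours s j))) (applyUpTo suc n)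

-- How a given coloured part occurs: not at all, or suc k times with the first
-- occurrence either not overlined (plain k) or overlined (overlined k).
data Occurrence : Set where
  absent    : Occurrence
  plain     : (k : ℕ) → Occurrence
  overlined : (k : ℕ) → Occurrence

multiplicity : Occurrence → ℕ
multiplicity absent        = 0
multiplicity (plain k)     = suc k
multiplicity (overlined k) = suc k

Assignment : ∀ {s} → List (Part s) → Set
Assignment = All (const Occurrence)

weight : ∀ {s} {ps : List (Part s)} → Assignment ps → ℕ
weight []                 = 0
weight (_∷_ {x = x} o os) = multiplicity o * size x + weight os

occurrences : ℕ → List Occurrence
occurrences n = absent ∷ map plain (upTo n) ++ map overlined (upTo n)

assignments : ∀ {s} → ℕ → (ps : List (Part s)) → List (Assignment ps)
assignments n []       = [] ∷ []
assignments n (p ∷ ps) = cartesianProductWith _∷_ (occurrences n) (assignments n ps)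

-- A partition of n is encoded by the multiplicities of its parts, so only
-- parts of size at most n, each occurring at most n times, are relevant; see
-- overpartitions-complete and overpartitions-unique.
overpartitions : ∀ s n → List (Assignment (parts s n))
overpartitions s n = filter (λ v → weight v ≟ n) (assignments n (parts s n))

ā : ℕ → ℕ → ℕ
ā s n = length (overpartitions s n)

private
  occurrences-complete : ∀ n o → multiplicity o ≤ n → o ∈ occurrences n
  occurrences-complete n absent        _ = here refl
  occurrences-complete n (plain k)     h = there (∈-++⁺ˡ (∈-map⁺ plain (∈-upTo⁺ h)))
  occurrences-complete n (overlined k) h =
    there (∈-++⁺ʳ (map plain (upTo n)) (∈-map⁺ overlined (∈-upTo⁺ h)))

  assignments-complete : ∀ {s} n {ps : List (Part s)} → All (λ p → NonZero (size p)) ps →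
                         (v : Assignment ps) → weight v ≤ n → v ∈ assignments n ps
  assignments-complete n []         []       _ = here refl
  assignments-complete n {p ∷ ps} (nz ∷ nzs) (o ∷ os) h =
    ∈-cartesianProductWith⁺ _∷_
      (occurrences-complete n o
        (≤-trans (m≤m*n (multiplicity o) (size p) {{nz}}) (≤-trans (m≤m+n _ (weight os)) h)))
      (assignments-complete n nzs os (≤-trans (m≤n+m _ (multiplicity o * size p)) h))

  parts-nonZero : ∀ s n → All (λ p → NonZero (size p)) (parts s n)
  parts-nonZero s n =
    concat⁺ (map⁺ (All.map (λ nz → map⁺ (All.tabulate λ _ → nz))
                           (applyUpTo⁺₂ {P = NonZero} suc n (λ _ → _))))

  occurrences-unique : ∀ n → Unique (occurrences n)
  occurrences-unique n =
    All.tabulate absent≢ AllPairs.∷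
    Unique.++⁺ (Unique.map⁺ (λ { refl → refl }) (Unique.upTo⁺ n))
               (Unique.map⁺ (λ { refl → refl }) (Unique.upTo⁺ n))
               disjoint
    where
    disjoint : ∀ {o} → o ∈ map plain (upTo n) × o ∈ map overlined (upTo n) → ⊥
    disjoint (a , b) with ∈-map⁻ plain a | ∈-map⁻ overlined b
    ... | _ , _ , refl | _ , _ , ()

    absent≢ : ∀ {o} → o ∈ map plain (upTo n) ++ map overlined (upTo n) → absent ≢ o
    absent≢ h refl with ∈-++⁻ (map plain (upTo n)) h
    ... | inj₁ a with () ← proj₂ (proj₂ (∈-map⁻ plain a))
    ... | inj₂ b with () ← proj₂ (proj₂ (∈-map⁻ overlined b))

  assignments-unique : ∀ {s} n (ps : List (Part s)) → Unique (assignments n ps)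
  assignments-unique n []       = [] AllPairs.∷ AllPairs.[]
  assignments-unique n (p ∷ ps) =
    Unique.cartesianProductWith⁺ _∷_ (λ { refl → refl , refl })
      (occurrences-unique n) (assignments-unique n ps)

overpartitions-complete : ∀ s n (v : Assignment (parts s n)) → v ∈ overpartitions s n ⇔ weight v ≡ n
overpartitions-complete s n v = mk⇔
  (λ h → proj₂ (∈-filter⁻ (λ v → weight v ≟ n) {xs = assignments n (parts s n)} h))
  (λ h → ∈-filter⁺ (λ v → weight v ≟ n)
           (assignments-complete n (parts-nonZero s n) v (≤-reflexive h)) h)

overpartitions-unique : ∀ s n → Unique (overpartitions s n)
overpartitions-unique s n =
  Unique.filter⁺ (λ v → weight v ≟ n) (assignments-unique n (parts s n))

{-# OPTIONS --safe #-}
module Submission where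

-- With θ = Σ q^(n²), φ = 1 + 2θ and E = 1 / φ(-q²), Gauss' identity turns the generating function of ā_s into
-- φ^s E^(s+1).  Expanding in powers of 2 shows that, for N ≡ 3 (mod 4), ā_s(N) is congruent to a multiple of
-- 2^(m+2) r(N) modulo 2^(m+3), respectively of 8 r(N) modulo 16, where r(N) counts the x, y ≥ 1 with x² + 2y² = N.
-- If N ≡ 7 (mod 8) then r(N) = 0.  If N ≡ 3 (mod 8), involutions on the solutions of x² + 2yz = N (T. Jackson's
-- analogue of the Heath-Brown–Zagier proof) give r(N) ≡ d(N)/2 (mod 2); for N = p^(2k+1) M with p ∤ M this is
-- (k+1) d(M), and d(M) is even because M ≡ 3 (mod 4) is not a square.

open import Defs
open import Algebra using (CommutativeRing; IsCommutativeRing)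
import Algebra.Properties.CommutativeSemiring.Exp as Exp
import Algebra.Properties.Ring as RingProperties
import Algebra.Solver.Ring as RingSolver
open import Algebra.Solver.Ring.AlmostCommutativeRing using (_-Raw-AlmostCommutative⟶_; fromCommutativeRing)
open import Data.Bool using (Bool; true; false; not; if_then_else_)
open import Data.Bool.Properties using (not-injective)
open import Data.Empty using (⊥; ⊥-elim)
open import Data.Fin using (Fin; toℕ; fromℕ<)
open import Data.Fin.Properties using (all?; toℕ-fromℕ<)
open import Data.Integer as ℤ using (ℤ; +_; -[1+_]; ∣_∣; 0ℤ)
open import Data.Integer.Divisibility.Signed as ℤ∣ using () renaming (_∣_ to _∣ℤ_)
import Data.Integer.Properties as ℤ
open import Data.Integer.Solver using (module +-*-Solver)
open import Data.List using (List; []; _∷_; _∷ʳ_; _++_; map; concatMap; cartesianProduct; cartesianProductWith; applyUpTo; upTo; allFin; filter; length)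
open import Data.List.Membership.Propositional using (_∈_)
open import Data.List.Membership.Propositional.Properties using (∈-map⁺; ∈-map⁻; ∈-++⁺ˡ; ∈-++⁺ʳ; ∈-upTo⁺; ∈-applyUpTo⁺; ∈-applyUpTo⁻; ∈-cartesianProduct⁺; ∈-cartesianProduct⁻; ∈-filter⁺; ∈-filter⁻)
open import Data.List.Membership.Propositional.Properties.WithK using (unique∧set⇒bag)
open import Data.List.Properties using (applyUpTo-∷ʳ; length-tabulate; filter-accept; filter-reject; filter-none; length-map; map-∘; map-id-local)
open import Data.List.Relation.Binary.BagAndSetEquality using (∼bag⇒↭)
open import Data.List.Relation.Binary.Permutation.Propositional.Properties using (↭-length)
open import Data.List.Relation.Unary.All using ([]; _∷_)
import Data.List.Relation.Unary.All as All
open import Data.List.Relation.Unary.Any using (here)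
import Data.List.Relation.Unary.Unique.Propositional as Unique
import Data.List.Relation.Unary.Unique.Propositional.Properties as Unique
open import Data.Maybe as Maybe using ()
open import Data.Nat as ℕ using (ℕ; zero; suc; _≤_; _<_; z≤n; s≤s; _≡ᵇ_; NonZero)
open import Data.Nat.Divisibility using (_∣_; _∤_; _∣?_; divides; m%n≡0⇒n∣m; n∣m⇒m%n≡0; ∣m⇒∣m*n; ∣m+n∣m⇒∣n; m∣m*n; ∣m∣n⇒∣m+n; _∣0)
open import Data.Nat.DivMod using (_%_; _/_; m%n<n; m%n%n≡m%n; %-distribˡ-*; %-distribˡ-+; [m+kn]%n≡m%n; m∣n⇒o%n%m≡o%m; m*n/n≡m; m/n*n≡m; m≡m%n+[m/n]*n; +-distrib-/-∣ʳ)
open import Data.Nat.Primality using (Prime; euclidsLemma; prime⇒nonZero)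
import Data.Nat.Properties as ℕ
open import Data.Nat.Solver using () renaming (module +-*-Solver to ℕ-Solver)
open import Data.Product using (_×_; _,_; ∃; proj₁; proj₂)
open import Data.Sum using (_⊎_; inj₁; inj₂)
open import Function using (_∘_; mk⇔)
open import Level using (0ℓ)
open import Relation.Binary.Definitions using (tri<; tri≈; tri>)
open import Relation.Binary.PropositionalEquality as ≡ using (_≡_; _≢_)
open import Relation.Nullary using (¬_; yes; no; ¬?)
open import Relation.Nullary.Decidable using (dec⇒maybe; from-yes; map′; _×-dec_)
open import Relation.Unary using (Decidable)

-- Formal power series

-- Three kinds of term occur in the expansions. Series in q² contribute nothing at the odd exponent
-- N. The terms θ, θ² and θ(q)θ(q⁴) would count ways to write N as a square or as a sum of two
-- squares, impossible for N ≡ 3 (mod 4). Higher powers reduce to these by θ(q)² ≡ θ(q²) (mod 2), so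
-- that only θ(q)θ(q²), with coefficient r(N), is left. The powers of 2 come from O = φE, the
-- product over the odd parts: O² - 1 = (φ(q)² - φ(-q²)²) E² is divisible by 4, and each further
-- squaring gains a factor 2. The parity of r(N) is obtained by seeing the solutions of x² + 2y² = N
-- as the fixed points y = z of an involution on x² + 2yz = N. Another involution has the fixed
-- points x = y, where N = x(x + 2z) is a factorisation. It lives on a different region, and the
-- difference of the two regions must be shown to be even: two more involutions act there, whose
-- fixed points would give N = a² + b² or N = a² - 2b². The second form is excluded for N ≡ 3 but
-- not for N ≡ 7 (mod 8), hence the case distinction.

module PowerSeries where
  open ≡ using (refl; sym; trans; cong; cong₂; module ≡-Reasoning)

  open +-*-Solver using (solve; _:+_; _:*_; :-_; con; _:=_)

  Series : Set
  Series = ℕ → ℤ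

  const : ℤ → Series
  const c zero    = c
  const c (suc _) = ℤ.0ℤ

  infixl 6 _⊕_
  infixl 7 _⊛_
  infix  8 ⊖_

  -- The Cauchy product recurses on `f = f 0 + q (f ∘ suc)`, which avoids sums over pairs of
  -- indices.
  _⊕_ _⊛_ : Series → Series → Series
  (f ⊕ g) n = f n ℤ.+ g n
  (f ⊛ g) zero    = f 0 ℤ.* g 0
  (f ⊛ g) (suc n) = f 0 ℤ.* g (suc n) ℤ.+ (f ∘ suc ⊛ g) n

  ⊖_ : Series → Series
  (⊖ f) n = ℤ.- f n

  infix 4 _≃[_]_
  _≃[_]_ : Series → ℕ → Series → Set
  f ≃[ N ] g = ∀ n → n ≤ N → f n ≡ g n

  ⊛-cong : ∀ {N f f′ g g′} → f ≃[ N ] f′ → g ≃[ N ] g′ → f ⊛ g ≃[ N ] f′ ⊛ g′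
  ⊛-cong p q zero    h = cong₂ ℤ._*_ (p 0 h) (q 0 h)
  ⊛-cong {suc N} p q (suc n) (s≤s h) = cong₂ ℤ._+_
    (cong₂ ℤ._*_ (p 0 z≤n) (q (suc n) (s≤s h)))
    (⊛-cong {N} (λ i i≤N → p (suc i) (s≤s i≤N)) (λ i i≤N → q i (ℕ.m≤n⇒m≤1+n i≤N)) n h)

  ⊛-congˡ : ∀ {f f′} g → (∀ i → f i ≡ f′ i) → ∀ n → (f ⊛ g) n ≡ (f′ ⊛ g) n
  ⊛-congˡ g p n = ⊛-cong {n} (λ i _ → p i) (λ _ _ → refl) n ℕ.≤-refl

  ⊛-zeroˡ : ∀ {f} → (∀ i → f i ≡ ℤ.0ℤ) → ∀ g n → (f ⊛ g) n ≡ ℤ.0ℤ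
  ⊛-zeroˡ p g zero    = cong (ℤ._* g 0) (p 0)
  ⊛-zeroˡ p g (suc n) = cong₂ ℤ._+_ (cong (ℤ._* g (suc n)) (p 0)) (⊛-zeroˡ (p ∘ suc) g n)

  const-⊛ : ∀ c g n → (const c ⊛ g) n ≡ c ℤ.* g n
  const-⊛ c g zero    = refl
  const-⊛ c g (suc n) =
    trans (cong (λ t → c ℤ.* g (suc n) ℤ.+ t) (⊛-zeroˡ (λ _ → refl) g n)) (ℤ.+-identityʳ _)

  ⊛-distribʳ-⊕ : ∀ f g h n → ((f ⊕ g) ⊛ h) n ≡ (f ⊛ h ⊕ g ⊛ h) n
  ⊛-distribʳ-⊕ f g h zero    = ℤ.*-distribʳ-+ (h 0) (f 0) (g 0)
  ⊛-distribʳ-⊕ f g h (suc n) = trans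
    (cong (λ t → (f 0 ℤ.+ g 0) ℤ.* h (suc n) ℤ.+ t) (⊛-distribʳ-⊕ (f ∘ suc) (g ∘ suc) h n))
    (solve 5 (λ a b c x y → (a :+ b) :* c :+ (x :+ y) := (a :* c :+ x) :+ (b :* c :+ y)) refl
      (f 0) (g 0) (h (suc n)) ((f ∘ suc ⊛ h) n) ((g ∘ suc ⊛ h) n))

  ⊛-scaleˡ : ∀ c f g n → ((λ i → c ℤ.* f i) ⊛ g) n ≡ c ℤ.* (f ⊛ g) n
  ⊛-scaleˡ c f g zero    = ℤ.*-assoc c (f 0) (g 0)
  ⊛-scaleˡ c f g (suc n) = trans
    (cong (λ t → c ℤ.* f 0 ℤ.* g (suc n) ℤ.+ t) (⊛-scaleˡ c (f ∘ suc) g n))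
    (solve 4 (λ c a b x → c :* a :* b :+ c :* x := c :* (a :* b :+ x)) refl
      c (f 0) (g (suc n)) ((f ∘ suc ⊛ g) n))

  -- The mirror image of the defining recursion, splitting off the constant term of the right
  -- factor; commutativity exchanges the two.
  ⊛-suc : ∀ f g n → (f ⊛ g) (suc n) ≡ f (suc n) ℤ.* g 0 ℤ.+ (f ⊛ g ∘ suc) n
  ⊛-suc f g zero    = ℤ.+-comm (f 0 ℤ.* g 1) _
  ⊛-suc f g (suc n) = trans
    (cong (λ t → f 0 ℤ.* g (suc (suc n)) ℤ.+ t) (⊛-suc (f ∘ suc) g n))
    (solve 3 (λ a b c → a :+ (b :+ c) := b :+ (a :+ c)) refl
      (f 0 ℤ.* g (suc (suc n))) (f (suc (suc n)) ℤ.* g 0) ((f ∘ suc ⊛ g ∘ suc) n))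

  ⊛-comm : ∀ f g n → (f ⊛ g) n ≡ (g ⊛ f) n
  ⊛-comm f g zero    = ℤ.*-comm (f 0) (g 0)
  ⊛-comm f g (suc n) = trans
    (cong₂ ℤ._+_ (ℤ.*-comm (f 0) (g (suc n))) (⊛-comm (f ∘ suc) g n))
    (sym (⊛-suc g f n))

  ⊛-assoc : ∀ f g h n → ((f ⊛ g) ⊛ h) n ≡ (f ⊛ (g ⊛ h)) n
  ⊛-assoc f g h zero    = ℤ.*-assoc (f 0) (g 0) (h 0)
  ⊛-assoc f g h (suc n) = begin
    f 0 ℤ.* g 0 ℤ.* h (suc n) ℤ.+ (((λ i → f 0 ℤ.* g (suc i)) ⊕ f ∘ suc ⊛ g) ⊛ h) n
      ≡⟨ cong (λ t → f 0 ℤ.* g 0 ℤ.* h (suc n) ℤ.+ t)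
           (trans (⊛-distribʳ-⊕ (λ i → f 0 ℤ.* g (suc i)) (f ∘ suc ⊛ g) h n)
                  (cong₂ ℤ._+_ (⊛-scaleˡ (f 0) (g ∘ suc) h n) (⊛-assoc (f ∘ suc) g h n))) ⟩
    f 0 ℤ.* g 0 ℤ.* h (suc n) ℤ.+ (f 0 ℤ.* (g ∘ suc ⊛ h) n ℤ.+ (f ∘ suc ⊛ (g ⊛ h)) n)
      ≡⟨ solve 5 (λ a b c x y → a :* b :* c :+ (a :* x :+ y) := a :* (b :* c :+ x) :+ y) refl
           (f 0) (g 0) (h (suc n)) ((g ∘ suc ⊛ h) n) ((f ∘ suc ⊛ (g ⊛ h)) n) ⟩
    f 0 ℤ.* (g ⊛ h) (suc n) ℤ.+ (f ∘ suc ⊛ (g ⊛ h)) n ∎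
    where open ≡-Reasoning

  isCommutativeRing : ∀ N → IsCommutativeRing (λ f g → f ≃[ N ] g) _⊕_ _⊛_ ⊖_ (const ℤ.0ℤ) (const ℤ.1ℤ)
  isCommutativeRing N = record
    { isRing = record
      { +-isAbelianGroup = record
        { isGroup = record
          { isMonoid = record
            { isSemigroup = record
              { isMagma = record
                { isEquivalence = record
                  { refl  = λ _ _ → refl
                  ; sym   = λ p n h → sym (p n h)
                  ; trans = λ p q n h → trans (p n h) (q n h)
                  }
                ; ∙-cong = λ p q n h → cong₂ ℤ._+_ (p n h) (q n h)
                }
              ; assoc = λ f g h n _ → ℤ.+-assoc (f n) (g n) (h n)
              }
            ; identity = (λ f n _ → trans (cong (ℤ._+ f n) (const-0 n)) (ℤ.+-identityˡ (f n)))
                       , (λ f n _ → trans (cong (λ t → f n ℤ.+ t) (const-0 n)) (ℤ.+-identityʳ (f n)))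
            }
          ; inverse = (λ f n _ → trans (ℤ.+-inverseˡ (f n)) (sym (const-0 n)))
                    , (λ f n _ → trans (ℤ.+-inverseʳ (f n)) (sym (const-0 n)))
          ; ⁻¹-cong = λ p n h → cong ℤ.-_ (p n h)
          }
        ; comm = λ f g n _ → ℤ.+-comm (f n) (g n)
        }
      ; *-cong = ⊛-cong
      ; *-assoc = λ f g h n _ → ⊛-assoc f g h n
      ; *-identity = (λ f n _ → identityˡ f n) , (λ f n _ → trans (⊛-comm f (const ℤ.1ℤ) n) (identityˡ f n))
      ; distrib = (λ f g h n _ → trans (⊛-comm f (g ⊕ h) n) (trans (⊛-distribʳ-⊕ g h f n)
                                   (cong₂ ℤ._+_ (⊛-comm g f n) (⊛-comm h f n))))
                , (λ f g h n _ → ⊛-distribʳ-⊕ g h f n)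
      }
    ; *-comm = λ f g n _ → ⊛-comm f g n
    }
    where
    const-0 : ∀ n → const ℤ.0ℤ n ≡ ℤ.0ℤ
    const-0 zero    = refl
    const-0 (suc _) = refl

    identityˡ : ∀ f n → (const ℤ.1ℤ ⊛ f) n ≡ f n
    identityˡ f n = trans (const-⊛ ℤ.1ℤ f n) (ℤ.*-identityˡ (f n))

  -- ℤ[[q]] / (q^(N+1)); working modulo q^(N+1) makes q nilpotent, so that all sums and products are finite.
  truncated : ℕ → CommutativeRing 0ℓ 0ℓ
  truncated N = record { isCommutativeRing = isCommutativeRing N }

  -- Lets the ring solver work on series with integer coefficients.
  const-homomorphism : ∀ N →
    CommutativeRing.rawRing ℤ.+-*-commutativeRing -Raw-AlmostCommutative⟶ fromCommutativeRing (truncated N)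
  const-homomorphism N = record
    { ⟦_⟧    = const
    ; +-homo = λ { a b zero _ → refl ; a b (suc n) _ → refl }
    ; *-homo = λ { a b zero _ → refl
                 ; a b (suc n) _ → sym (trans (const-⊛ a (const b) (suc n)) (ℤ.*-zeroʳ a)) }
    ; -‿homo = λ { a zero _ → refl ; a (suc n) _ → refl }
    ; 0-homo = λ _ _ → refl
    ; 1-homo = λ _ _ → refl
    }

-- Gauss' identity and theta quotients

odd? : ℕ → Bool
odd? n = n % 2 ≡ᵇ 1

odd?-suc : ∀ n → odd? (suc n) ≡ not (odd? n)
odd?-suc zero          = ≡.refl
odd?-suc (suc zero)    = ≡.refl
odd?-suc (suc (suc n)) = odd?-suc n

odd?-double : ∀ n → odd? (n ℕ.* 2) ≡ false
odd?-double zero    = ≡.refl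
odd?-double (suc n) = odd?-double n

odd?-2* : ∀ n → odd? (2 ℕ.* n) ≡ false
odd?-2* n = ≡.trans (≡.cong odd? (ℕ.*-comm 2 n)) (odd?-double n)

odd?-suc-double : ∀ n → odd? (suc (n ℕ.* 2)) ≡ true
odd?-suc-double zero    = ≡.refl
odd?-suc-double (suc n) = odd?-suc-double n

module ℤ-Algebra
  (R : CommutativeRing 0ℓ 0ℓ)
  (η : CommutativeRing.rawRing ℤ.+-*-commutativeRing -Raw-AlmostCommutative⟶ fromCommutativeRing R)
  where

  open CommutativeRing R hiding (zero) public
  open Exp commutativeSemiring using (_^_; ^-congˡ; ^-congʳ; ^-homo-*; ^-assocʳ; ^-distrib-*) public
  open RingProperties ring using (x∙y⁻¹≈ε⇒x≈y; -‿distribˡ-*) public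
  open _-Raw-AlmostCommutative⟶_ η using (+-homo; *-homo; 0-homo; 1-homo) renaming (⟦_⟧ to ι) public
  open RingSolver (CommutativeRing.rawRing ℤ.+-*-commutativeRing) (fromCommutativeRing R) η
    (λ a b → Maybe.map (λ a≡b → reflexive (≡.cong ι a≡b)) (dec⇒maybe (a ℤ.≟ b)))
    using (solve; _:=_; _:+_; _:*_; _:-_; :-_; con; Polynomial) public
  open import Relation.Binary.Reasoning.Setoid setoid public

  infix 9 #_
  -- Images of integers are the constants that the solver normalises. A power `x ^ 0` is the ring's
  -- own `1#`, so `#1≈1` has to mediate wherever a power bottoms out.
  #_ : ℕ → Carrier
  # n = ι (+ n)

  infix 9 :#_
  :#_ : ∀ {m} → ℕ → Polynomial m
  :# n = con (+ n)

  #0≈0 : # 0 ≈ 0#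
  #0≈0 = 0-homo

  #1≈1 : # 1 ≈ 1#
  #1≈1 = 1-homo

  #0*-zero : ∀ x → # 0 * x ≈ # 0
  #0*-zero = solve 1 (λ x → :# 0 :* x := :# 0) refl

  #1*-identity : ∀ x → # 1 * x ≈ x
  #1*-identity = solve 1 (λ x → :# 1 :* x := x) refl

  x-y≈0⇒x≈y : ∀ {x y} → x - y ≈ # 0 → x ≈ y
  x-y≈0⇒x≈y h = x∙y⁻¹≈ε⇒x≈y _ _ (trans h #0≈0)

  x≈y⇒x-y≈0 : ∀ {x y} → x ≈ y → x - y ≈ # 0
  x≈y⇒x-y≈0 {x} {y} h = trans (+-congʳ h) (solve 1 (λ y → y :- y := :# 0) refl y)

  -- Membership certificates: x - y is exhibited in the ideal generated by the differences of known equations.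
  modulo : ∀ {x y p q} c → p ≈ q → x - y ≈ c * (p - q) → x ≈ y
  modulo c p≈q h = x-y≈0⇒x≈y (trans h (trans (*-congˡ (x≈y⇒x-y≈0 p≈q))
    (solve 1 (λ c → c :* :# 0 := :# 0) refl c)))

  modulo₂ : ∀ {x y p q p′ q′} c c′ → p ≈ q → p′ ≈ q′ →
            x - y ≈ c * (p - q) + c′ * (p′ - q′) → x ≈ y
  modulo₂ c c′ e e′ h = x-y≈0⇒x≈y (trans h (trans
    (+-cong (*-congˡ (x≈y⇒x-y≈0 e)) (*-congˡ (x≈y⇒x-y≈0 e′)))
    (solve 2 (λ c c′ → c :* :# 0 :+ c′ :* :# 0 := :# 0) refl c c′)))

  sum product : ℕ → (ℕ → Carrier) → Carrier
  sum zero    f = # 0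
  sum (suc n) f = sum n f + f (suc n)
  product zero    f = # 1
  product (suc n) f = product n f * f (suc n)

  sum-cong : ∀ {f g} n → (∀ k → f (suc k) ≈ g (suc k)) → sum n f ≈ sum n g
  sum-cong zero    h = refl
  sum-cong (suc n) h = +-cong (sum-cong n h) (h n)

  product-cong : ∀ {f g} n → (∀ k → f (suc k) ≈ g (suc k)) → product n f ≈ product n g
  product-cong zero    h = refl
  product-cong (suc n) h = *-cong (product-cong n h) (h n)

  product-* : ∀ n f g → product n (λ k → f k * g k) ≈ product n f * product n g
  product-* zero    f g = sym (#1*-identity (# 1))
  product-* (suc n) f g = trans (*-congʳ (product-* n f g))
    (solve 4 (λ a b c d → a :* b :* (c :* d) := a :* c :* (b :* d)) refl (product n f) (product n g) (f (suc n)) (g (suc n)))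

  product-1 : ∀ {f} n → (∀ k → f (suc k) ≈ # 1) → product n f ≈ # 1
  product-1 zero    h = refl
  product-1 (suc n) h = trans (*-cong (product-1 n h) (h n)) (#1*-identity (# 1))

  product-^ : ∀ n f k → product n (λ j → f j ^ k) ≈ product n f ^ k
  product-^ zero    f zero = #1≈1
  product-^ zero    f (suc k) = sym (trans (#1*-identity _) (sym (product-^ zero f k)))
  product-^ (suc n) f k = trans (*-congʳ (product-^ n f k)) (sym (^-distrib-* (product n f) (f (suc n)) k))

  -x*y : ∀ x y → - (x * y) ≈ x * - y
  -x*y = solve 2 (λ x y → :- (x :* y) := x :* :- y) refl

  -- Geometric sums of nilpotent elements and the finite form of Gauss' identity

  module Truncation (N : ℕ) where

    Nilpotent : Carrier → Set
    Nilpotent x = x ^ suc N ≈ # 0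

    nilpotent-* : ∀ {x} y → Nilpotent x → Nilpotent (x * y)
    nilpotent-* {x} y h = trans (^-distrib-* x y (suc N)) (trans (*-congʳ h) (#0*-zero _))

    nilpotent-neg : ∀ {x} → Nilpotent x → Nilpotent (- x)
    nilpotent-neg {x} h = trans (^-congˡ (suc N) (solve 1 (λ x → :- x := x :* (:- :# 1)) refl x)) (nilpotent-* (- # 1) h)

    geometric : Carrier → Carrier
    geometric y = sum N (y ^_)

    geometric-sum : ∀ y → geometric y * (# 1 - y) ≈ y - y ^ suc N
    geometric-sum y = go N
      where
      go : ∀ n → sum n (y ^_) * (# 1 - y) ≈ y - y ^ suc n
      go zero    = begin
        # 0 * (# 1 - y)  ≈⟨ solve 1 (λ y → :# 0 :* (:# 1 :- y) := y :- y :* :# 1) refl y ⟩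
        y - y * # 1      ≈⟨ +-congˡ (-‿cong (*-congˡ #1≈1)) ⟩
        y - y * 1#       ∎
      go (suc n) = begin
        (sum n (y ^_) + y * y ^ n) * (# 1 - y)
          ≈⟨ solve 3 (λ s y z → (s :+ y :* z) :* (:# 1 :- y) := s :* (:# 1 :- y) :+ (y :* z :- y :* (y :* z))) refl (sum n (y ^_)) y (y ^ n) ⟩
        sum n (y ^_) * (# 1 - y) + (y * y ^ n - y * (y * y ^ n))
          ≈⟨ +-congʳ (go n) ⟩
        y - y * y ^ n + (y * y ^ n - y * (y * y ^ n))
          ≈⟨ solve 3 (λ y a b → y :- a :+ (a :- b) := y :- b) refl y (y * y ^ n) (y * (y * y ^ n)) ⟩
        y - y * (y * y ^ n) ∎

    geometric-nilpotent : ∀ {y} → Nilpotent y → geometric y * (# 1 - y) ≈ y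
    geometric-nilpotent {y} h = trans (geometric-sum y) (trans (+-congˡ (-‿cong h))
      (solve 1 (λ y → y :- :# 0 := y) refl y))

    -- `# 1 + geometric y` inverts `# 1 - y`, so cancellation is possible although a truncated ring
    -- may have zero divisors.
    1-y-cancelˡ : ∀ {y a b} → Nilpotent y → (# 1 - y) * a ≈ (# 1 - y) * b → a ≈ b
    1-y-cancelˡ {y} {a} {b} h e = modulo₂ (b - a) (# 1 + geometric y) (geometric-nilpotent h) e
      (solve 4 (λ y a b g → a :- b := (b :- a) :* (g :* (:# 1 :- y) :- y) :+ (:# 1 :+ g) :* ((:# 1 :- y) :* a :- (:# 1 :- y) :* b)) refl
        y a b (geometric y))

    -- cayley y = (1 + y) / (1 - y)
    cayley : Carrier → Carrier
    cayley y = # 1 + # 2 * geometric y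

    cayley-equation : ∀ {y} → Nilpotent y → cayley y * (# 1 - y) ≈ # 1 + y
    cayley-equation {y} h = modulo (# 2) (geometric-nilpotent h)
      (solve 2 (λ g y → (:# 1 :+ :# 2 :* g) :* (:# 1 :- y) :- (:# 1 :+ y) := :# 2 :* (g :* (:# 1 :- y) :- y)) refl (geometric y) y)

    cayley-neg-equation : ∀ {y} → Nilpotent y → cayley (- y) * (# 1 + y) ≈ # 1 - y
    cayley-neg-equation {y} h = trans (*-congˡ (solve 1 (λ y → :# 1 :+ y := :# 1 :- :- y) refl y)) (cayley-equation (nilpotent-neg h))

    cayley-neg : ∀ {y} → Nilpotent y → cayley (- y) * cayley y ≈ # 1
    cayley-neg {y} h = 1-y-cancelˡ h (modulo₂ (cayley (- y)) (# 1) (cayley-equation h) (cayley-neg-equation h)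
      (solve 3 (λ y a b → (:# 1 :- y) :* (a :* b) :- (:# 1 :- y) :* :# 1 :=
                           a :* (b :* (:# 1 :- y) :- (:# 1 :+ y)) :+ :# 1 :* (a :* (:# 1 :+ y) :- (:# 1 :- y)))
        refl y (cayley (- y)) (cayley y)))

    geometric-cong : ∀ {x y} → x ≈ y → geometric x ≈ geometric y
    geometric-cong h = sum-cong N (λ k → ^-congˡ (suc k) h)

    cayley-cong : ∀ {x y} → x ≈ y → cayley x ≈ cayley y
    cayley-cong h = +-congˡ (*-congˡ (geometric-cong h))

    cayley-0 : ∀ {y} → y ≈ # 0 → cayley y ≈ # 1
    cayley-0 {y} h = trans (+-congˡ (*-congˡ (zero-sum N))) (solve 0 (:# 1 :+ :# 2 :* :# 0 := :# 1) refl)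
      where
      zero-sum : ∀ n → sum n (y ^_) ≈ # 0
      zero-sum zero    = refl
      zero-sum (suc n) = trans (+-cong (zero-sum n) (trans (*-congʳ h) (#0*-zero _))) (solve 0 (:# 0 :+ :# 0 := :# 0) refl)

    -- A_n U(x^(n+1), n) telescopes: going from n - 1 to n adds exactly 2 (-1)^n x^(n²).  This is a finite form of
    -- Gauss' identity ∏ (1 - x^j) / (1 + x^j) = Σ (-1)^n x^(n²), in the style of Shanks.
    module Gauss (x : Carrier) (x-nilpotent : Nilpotent x) where

      pow-nilpotent : ∀ n → Nilpotent (x ^ suc n)
      pow-nilpotent n = nilpotent-* (x ^ n) x-nilpotent

      A B : ℕ → Carrier
      A n = product n (λ j → cayley (- (x ^ j)))
      B n = product n (λ j → cayley (x ^ j))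

      A*B≈1 : ∀ n → A n * B n ≈ # 1
      A*B≈1 n = trans (sym (product-* n _ _)) (product-1 n (λ k → cayley-neg (pow-nilpotent k)))

      B-step : ∀ n → B (suc n) * (# 1 - x ^ suc n) ≈ B n * (# 1 + x ^ suc n)
      B-step n = trans (*-assoc _ _ _) (*-congˡ (cayley-equation (pow-nilpotent n)))

      -- By the q-binomial theorem, `U z r` tends to ∏ (1 - x^i z) / (1 + x^i z) over i ≥ 0 as r
      -- grows. So `A n * U (x ^ suc n) n` is `A n` times an approximation to the factors that it
      -- still lacks.
      U : Carrier → ℕ → Carrier
      U z zero    = # 1
      U z (suc r) = U z r + (B (suc r) + B r) * (- z) ^ suc r

      -- The limiting product satisfies (1 - z) U(xz) = (1 + z) U(z); stopping at `r` adds one error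
      -- term. In the induction `B-step` turns the error term for `r` into the one for `suc r`.
      U-step : ∀ z r → (# 1 - z) * U (x * z) r ≈ (# 1 + z) * U z r + # 2 * B r * (- z) ^ suc r
      U-step z zero = begin
        (# 1 - z) * # 1
          ≈⟨ solve 1 (λ z → (:# 1 :- z) :* :# 1 := (:# 1 :+ z) :* :# 1 :+ :# 2 :* :# 1 :* (:- z :* :# 1)) refl z ⟩
        (# 1 + z) * # 1 + # 2 * # 1 * (- z * # 1)  ≈⟨ +-congˡ (*-congˡ (*-congˡ #1≈1)) ⟩
        (# 1 + z) * # 1 + # 2 * # 1 * (- z * 1#)   ∎
      U-step z (suc r) = begin
        (# 1 - z) * (U (x * z) r + (B (suc r) + B r) * (- (x * z)) ^ suc r)
          ≈⟨ *-congˡ (+-congˡ (*-congˡ (trans (^-congˡ (suc r) (-x*y x z)) (^-distrib-* x (- z) (suc r))))) ⟩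
        (# 1 - z) * (U (x * z) r + (B (suc r) + B r) * (X * Z))
          ≈⟨ modulo₂ (# 1) ((z - # 1) * Z) (U-step z r) (B-step r)
              (solve 7 (λ u′ u b′ b X Z z →
                (:# 1 :- z) :* (u′ :+ (b′ :+ b) :* (X :* Z))
                  :- ((:# 1 :+ z) :* (u :+ (b′ :+ b) :* Z) :+ :# 2 :* b′ :* (:- z :* Z))
                := :# 1 :* ((:# 1 :- z) :* u′ :- ((:# 1 :+ z) :* u :+ :# 2 :* b :* Z))
                   :+ ((z :- :# 1) :* Z) :* (b′ :* (:# 1 :- X) :- b :* (:# 1 :+ X)))
                refl (U (x * z) r) (U z r) (B (suc r)) (B r) X Z z) ⟩
        (# 1 + z) * (U z r + (B (suc r) + B r) * Z) + # 2 * B (suc r) * (- z * Z) ∎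
        where
        X Z : Carrier
        X = x ^ suc r
        Z = (- z) ^ suc r

      theta-term : ℕ → Carrier
      theta-term k = (- (x ^ k)) ^ k

      -- After multiplication by 1 - X, `U-step` at z = X replaces U(xX) by U(X), to which the
      -- induction hypothesis applies.
      partial-theta : ∀ n → A n * U (x ^ suc n) n ≈ # 1 + # 2 * sum n theta-term
      partial-theta zero    = solve 0 (:# 1 :* :# 1 := :# 1 :+ :# 2 :* :# 0) refl
      partial-theta (suc n) = 1-y-cancelˡ (pow-nilpotent n) (begin
        (# 1 - X) * (A n * a * U (x * X) (suc n))
          ≈⟨ solve 4 (λ s A a u → s :* (A :* a :* u) := A :* a :* (s :* u)) refl (# 1 - X) (A n) a (U (x * X) (suc n)) ⟩
        A n * a * ((# 1 - X) * U (x * X) (suc n))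
          ≈⟨ *-congˡ (U-step X (suc n)) ⟩
        A n * a * ((# 1 + X) * (U X n + (B (suc n) + B n) * C) + # 2 * B (suc n) * (- X * C))
          -- As (1 + X) B_n = (1 - X) B_(n+1), the top summand of `U X (suc n)` and the error term
          -- combine to 2 (1 - X) B_(n+1) C. The other summand uses a (1 + X) = 1 - X.
          ≈⟨ modulo₂ (A n * a * C) (A n * U X n) (sym (B-step n)) (cayley-neg-equation (pow-nilpotent n))
              (solve 7 (λ A a U X b′ b C →
                A :* a :* ((:# 1 :+ X) :* (U :+ (b′ :+ b) :* C) :+ :# 2 :* b′ :* (:- X :* C))
                  :- ((:# 1 :- X) :* (A :* U) :+ (:# 1 :- X) :* (:# 2 :* C :* (A :* a :* b′)))
                := (A :* a :* C) :* (b :* (:# 1 :+ X) :- b′ :* (:# 1 :- X))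
                   :+ (A :* U) :* (a :* (:# 1 :+ X) :- (:# 1 :- X)))
                refl (A n) a (U X n) X (B (suc n)) (B n) C) ⟩
        (# 1 - X) * (A n * U X n) + (# 1 - X) * (# 2 * C * (A n * a * B (suc n)))
          ≈⟨ +-cong (*-congˡ (partial-theta n)) (*-congˡ (*-congˡ (A*B≈1 (suc n)))) ⟩
        (# 1 - X) * (# 1 + # 2 * sum n theta-term) + (# 1 - X) * (# 2 * C * # 1)
          ≈⟨ solve 3 (λ X s C → (:# 1 :- X) :* (:# 1 :+ :# 2 :* s) :+ (:# 1 :- X) :* (:# 2 :* C :* :# 1)
                              := (:# 1 :- X) :* (:# 1 :+ :# 2 :* (s :+ C))) refl X (sum n theta-term) C ⟩
        (# 1 - X) * (# 1 + # 2 * (sum n theta-term + C)) ∎)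
        where
        X a C : Carrier
        X = x ^ suc n
        a = cayley (- X)
        C = (- X) ^ suc n

      -- At n = N the completing factors are trivial: x^(N+1) = 0 kills every summand except the
      -- leading 1.
      U-nilpotent : ∀ r → U (x ^ suc N) r ≈ # 1
      U-nilpotent zero    = refl
      U-nilpotent (suc r) = begin
        U (x ^ suc N) r + (B (suc r) + B r) * (- (x ^ suc N) * (- (x ^ suc N)) ^ r)
          ≈⟨ +-cong (U-nilpotent r) (*-congˡ (*-congʳ (-‿cong x-nilpotent))) ⟩
        # 1 + (B (suc r) + B r) * (- # 0 * (- (x ^ suc N)) ^ r)
          ≈⟨ solve 2 (λ b z → :# 1 :+ b :* (:- :# 0 :* z) := :# 1) refl (B (suc r) + B r) ((- (x ^ suc N)) ^ r) ⟩
        # 1 ∎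

      gauss : A N ≈ # 1 + # 2 * sum N theta-term
      gauss = trans (sym (trans (*-congˡ (U-nilpotent N)) (*-identityʳ′ (A N)))) (partial-theta N)
        where
        *-identityʳ′ : ∀ x → x * # 1 ≈ x
        *-identityʳ′ = solve 1 (λ x → x :* :# 1 := x) refl

  -- Congruences modulo an integer in a commutative ring

  infix 4 _≡_[mod_]
  infixr 4 _,_
  record _≡_[mod_] (x y : Carrier) (c : ℕ) : Set where
    constructor _,_
    field
      quotient : Carrier
      equality : x ≈ y + # c * quotient

  ≈⇒mod : ∀ {c x y} → x ≈ y → x ≡ y [mod c ]
  ≈⇒mod {c} {x} {y} h = # 0 , trans h (solve 2 (λ y c → y := y :+ c :* :# 0) refl y (# c))

  mod-trans : ∀ {c x y z} → x ≡ y [mod c ] → y ≡ z [mod c ] → x ≡ z [mod c ]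
  mod-trans {c} {x} {y} {z} (k , h) (l , i) = k + l , trans h (trans (+-congʳ i)
    (solve 4 (λ z c k l → z :+ c :* l :+ c :* k := z :+ c :* (k :+ l)) refl z (# c) k l))

  mod-+ : ∀ {c x y z w} → x ≡ y [mod c ] → z ≡ w [mod c ] → x + z ≡ y + w [mod c ]
  mod-+ {c} {x} {y} {z} {w} (k , h) (l , i) = k + l , trans (+-cong h i)
    (solve 5 (λ y c k w l → y :+ c :* k :+ (w :+ c :* l) := y :+ w :+ c :* (k :+ l)) refl y (# c) k w l)

  mod-- : ∀ {c x y z w} → x ≡ y [mod c ] → z ≡ w [mod c ] → x - z ≡ y - w [mod c ]
  mod-- {c} {x} {y} {z} {w} (k , h) (l , i) = k - l , trans (+-cong h (-‿cong i))
    (solve 5 (λ y c k w l → y :+ c :* k :- (w :+ c :* l) := y :- w :+ c :* (k :- l)) refl y (# c) k w l)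

  mod-* : ∀ {c x y z w} → x ≡ y [mod c ] → z ≡ w [mod c ] → x * z ≡ y * w [mod c ]
  mod-* {c} {x} {y} {z} {w} (k , h) (l , i) = k * w + y * l + # c * (k * l) , trans (*-cong h i)
    (solve 5 (λ y c k w l → (y :+ c :* k) :* (w :+ c :* l) := y :* w :+ c :* (k :* w :+ y :* l :+ c :* (k :* l))) refl y (# c) k w l)

  mod-refl : ∀ {c x} → x ≡ x [mod c ]
  mod-refl = ≈⇒mod refl

  mod-^ : ∀ {c x y} n → x ≡ y [mod c ] → x ^ n ≡ y ^ n [mod c ]
  mod-^ zero    h = mod-refl
  mod-^ (suc n) h = mod-* h (mod-^ n h)

  mod-scale : ∀ {c x y} d → x ≡ y [mod c ] → # d * x ≡ # d * y [mod d ℕ.* c ]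
  mod-scale {c} {x} {y} d (k , h) = k , trans (*-congˡ h) (trans
    (solve 4 (λ d y c k → d :* (y :+ c :* k) := d :* y :+ d :* c :* k) refl (# d) y (# c) k)
    (+-congˡ (*-congʳ (sym (trans (reflexive (≡.cong ι (ℤ.pos-* d c))) (*-homo (+ d) (+ c)))))))

  mod-sum : ∀ {c f g} n → (∀ k → f (suc k) ≡ g (suc k) [mod c ]) → sum n f ≡ sum n g [mod c ]
  mod-sum zero    h = mod-refl
  mod-sum (suc n) h = mod-+ (mod-sum n h) (h n)

  -- Cross terms come in equal pairs, so squaring is additive modulo 2.
  sum-square : ∀ n f → sum n f * sum n f ≡ sum n (λ k → f k * f k) [mod 2 ]
  sum-square zero    f = ≈⇒mod (solve 0 (:# 0 :* :# 0 := :# 0) refl)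
  sum-square (suc n) f = mod-trans
    (sum n f * f (suc n) , solve 2 (λ s a → (s :+ a) :* (s :+ a) := s :* s :+ a :* a :+ :# 2 :* (s :* a)) refl (sum n f) (f (suc n)))
    (mod-+ (sum-square n f) mod-refl)

  neg-mod-2 : ∀ x → - x ≡ x [mod 2 ]
  neg-mod-2 x = - x , solve 1 (λ x → :- x := x :+ :# 2 :* :- x) refl x

  neg-^ : ∀ y n → (- y) ^ n ≈ (if odd? n then - (y ^ n) else y ^ n)
  neg-^ y zero          = refl
  neg-^ y (suc zero)    = sym (-‿distribˡ-* y 1#)
  neg-^ y (suc (suc n)) with odd? n | neg-^ y n
  ... | true  | h = trans (*-congˡ (*-congˡ h)) (solve 2 (λ y z → :- y :* (:- y :* (:- z)) := :- (y :* (y :* z))) refl y (y ^ n))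
  ... | false | h = trans (*-congˡ (*-congˡ h)) (solve 2 (λ y z → :- y :* (:- y :* z) := y :* (y :* z)) refl y (y ^ n))

  product-extend : ∀ {f} k n → (∀ j → f (suc (j ℕ.+ n)) ≈ # 1) → product (k ℕ.+ n) f ≈ product n f
  product-extend zero    n h = refl
  product-extend {f} (suc k) n h = trans (*-cong (product-extend k n h) (h k)) (solve 1 (λ x → x :* :# 1 := x) refl (product n f))

  product-double : ∀ {f} n → (∀ j → f (suc (j ℕ.* 2)) ≈ # 1) → product (n ℕ.* 2) f ≈ product n (λ j → f (j ℕ.* 2))
  product-double zero    h = refl
  product-double (suc n) h = *-congʳ (trans (*-cong (product-double n h) (h n)) (solve 1 (λ x → x :* :# 1 := x) refl _))

  -- The products over odd and even parts as theta quotients, and their expansions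

  module ThetaQuotients (N : ℕ) (q : Carrier) (q-nilpotent : q ^ suc N ≈ # 0) where
    open Truncation N

    q² : Carrier
    q² = q ^ 2

    q²-nilpotent : Nilpotent q²
    q²-nilpotent = nilpotent-* (q ^ 1) q-nilpotent

    module G₋ = Gauss (- q) (nilpotent-neg q-nilpotent)
    module G₂ = Gauss q² q²-nilpotent

    -- `# 1 + # 2 * u` is φ(-q²), from Gauss' identity at q², while `v` and `w` are θ(q²) and θ(q⁴).
    -- Modulo 2 the signs in `u` disappear.
    θ u v w : Carrier
    θ = sum N (λ k → q ^ (k ℕ.* k))
    u = sum N G₂.theta-term
    v = sum N (λ k → q ^ (2 ℕ.* (k ℕ.* k)))
    w = sum N (λ k → q ^ (4 ℕ.* (k ℕ.* k)))

    odd-factor even-factor : ℕ → Carrier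
    odd-factor  j = if odd? j then cayley (q ^ j) else # 1
    even-factor j = if odd? j then # 1 else cayley (q ^ j)

    O E : Carrier
    O = product N odd-factor
    E = product N even-factor

    -- The sign (-1)^k of Gauss' identity cancels the sign of (-q)^(k²), since k² ≡ k (mod 2).
    θ-term : ∀ k → G₋.theta-term k ≈ q ^ (k ℕ.* k)
    θ-term k = trans (^-congˡ k (-‿cong (neg-^ q k))) (trans (lemma k) (^-assocʳ q k k))
      where
      lemma : ∀ k → (- (if odd? k then - (q ^ k) else q ^ k)) ^ k ≈ (q ^ k) ^ k
      lemma k with odd? k | neg-^ (q ^ k) k
      ... | true  | _ = ^-congˡ k (solve 1 (λ x → :- :- x := x) refl (q ^ k))
      ... | false | h = h

    -- Gauss' product at -q has the factor `cayley (q ^ j)` for odd j and its inverse for even j;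
    -- multiplying by `E` removes the even ones.
    θE≈O : (# 1 + # 2 * θ) * E ≈ O
    θE≈O = begin
      (# 1 + # 2 * θ) * E                        ≈⟨ *-congʳ (+-congˡ (*-congˡ (sum-cong N (λ k → θ-term (suc k))))) ⟨
      (# 1 + # 2 * sum N G₋.theta-term) * E      ≈⟨ *-congʳ G₋.gauss ⟨
      G₋.A N * E                                 ≈⟨ product-* N _ _ ⟨
      product N (λ j → cayley (- ((- q) ^ j)) * even-factor j)
        ≈⟨ product-cong N factor ⟩
      O ∎
      where
      factor : ∀ k → cayley (- ((- q) ^ suc k)) * even-factor (suc k) ≈ odd-factor (suc k)
      factor k with odd? (suc k) | neg-^ q (suc k)
      ... | true  | h = trans (*-congʳ (cayley-cong (trans (-‿cong h) (solve 1 (λ x → :- :- x := x) refl (q ^ suc k)))))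
                              (solve 1 (λ x → x :* :# 1 := x) refl _)
      ... | false | h = trans (*-congʳ (cayley-cong (-‿cong h))) (cayley-neg (nilpotent-* (q ^ k) q-nilpotent))

    q^large : ∀ k → q ^ (suc k ℕ.+ N) ≈ # 0
    q^large k = trans (^-congʳ q (≡.trans (≡.cong suc (ℕ.+-comm k N)) ≡.refl))
      (trans (^-homo-* q (suc N) k) (trans (*-congʳ q-nilpotent) (#0*-zero _)))

    -- `E` stops at index N while the product in q² reaches index 2N. The factors in between are 1,
    -- because q^j = 0 for j > N.
    E≈B : E ≈ G₂.B N
    E≈B = begin
      product N even-factor            ≈⟨ product-extend N N large ⟨
      product (N ℕ.+ N) even-factor    ≡⟨ ≡.cong (λ m → product m even-factor) (N+N≡N*2 N) ⟩
      product (N ℕ.* 2) even-factor    ≈⟨ product-double N small ⟩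
      product N (λ j → even-factor (j ℕ.* 2)) ≈⟨ product-cong N (λ k → term (suc k)) ⟩
      G₂.B N ∎
      where
      N+N≡N*2 : ∀ n → n ℕ.+ n ≡ n ℕ.* 2
      N+N≡N*2 = ℕ-Solver.solve 1 (λ n → n ℕ-Solver.:+ n ℕ-Solver.:= n ℕ-Solver.:* ℕ-Solver.con 2) ≡.refl

      large : ∀ j → even-factor (suc (j ℕ.+ N)) ≈ # 1
      large j with odd? (suc (j ℕ.+ N))
      ... | true  = refl
      ... | false = cayley-0 (q^large j)

      small : ∀ j → even-factor (suc (j ℕ.* 2)) ≈ # 1
      small j rewrite odd?-suc-double j = refl

      term : ∀ j → even-factor (j ℕ.* 2) ≈ cayley (q² ^ j)
      term j rewrite odd?-double j = cayley-cong (sym (trans (^-assocʳ q 2 j) (^-congʳ q (ℕ.*-comm 2 j))))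

    E-inverse : E * (# 1 + # 2 * u) ≈ # 1
    E-inverse = trans (*-cong E≈B (sym G₂.gauss)) (trans (*-comm _ _) (G₂.A*B≈1 N))

    u≡v : u ≡ v [mod 2 ]
    u≡v = mod-sum N (λ k → mod-trans (mod-^ (suc k) (neg-mod-2 (q² ^ suc k))) (≈⇒mod (term (suc k))))
      where
      term : ∀ k → (q² ^ k) ^ k ≈ q ^ (2 ℕ.* (k ℕ.* k))
      term k = trans (^-assocʳ q² k k) (^-assocʳ q 2 (k ℕ.* k))

    q^-double : ∀ m → q ^ m * q ^ m ≈ q ^ (2 ℕ.* m)
    q^-double m = trans (sym (^-homo-* q m m)) (^-congʳ q (≡.cong (m ℕ.+_) (≡.sym (ℕ.+-identityʳ m))))

    θ²≡v : θ * θ ≡ v [mod 2 ]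
    θ²≡v = mod-trans (sum-square N _) (≈⇒mod (sum-cong N (λ k → q^-double (suc k ℕ.* suc k))))

    v²≡w : v * v ≡ w [mod 2 ]
    v²≡w = mod-trans (sum-square N _) (≈⇒mod (sum-cong N (λ k → trans (q^-double (2 ℕ.* (suc k ℕ.* suc k)))
      (^-congʳ q (≡.sym (ℕ.*-assoc 2 2 (suc k ℕ.* suc k)))))))

    -- `κ` is (O² - 1)/4 in closed form: from E (1 + 2u) = 1 follows O² - 1 = (φ² - (1 + 2u)²) E²,
    -- and a square (1 + 2t)² is 1 + 4 (t + t²).
    φ κ : Carrier
    φ = # 1 + # 2 * θ
    κ = (θ + θ * θ - u - u * u) * (E * E)

    O²≈1+4κ : O * O ≈ # 1 + # 4 * κ
    O²≈1+4κ = trans (*-cong (sym θE≈O) (sym θE≈O)) (modulo (# 1 + E * (# 1 + # 2 * u)) E-inverse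
      (solve 3 (λ θ u E → (:# 1 :+ :# 2 :* θ) :* E :* ((:# 1 :+ :# 2 :* θ) :* E)
                   :- (:# 1 :+ :# 4 :* ((θ :+ θ :* θ :- u :- u :* u) :* (E :* E)))
                := (:# 1 :+ E :* (:# 1 :+ :# 2 :* u)) :* (E :* (:# 1 :+ :# 2 :* u) :- :# 1)) refl θ u E))

    E≡1-2u : E ≡ # 1 - # 2 * u [mod 4 ]
    E≡1-2u = u * u * E , modulo (# 1 - # 2 * u) E-inverse
      (solve 2 (λ u E → E :- (:# 1 :- :# 2 :* u :+ :# 4 :* (u :* u :* E))
                := (:# 1 :- :# 2 :* u) :* (E :* (:# 1 :+ :# 2 :* u) :- :# 1)) refl u E)

    E≡1 : E ≡ # 1 [mod 2 ]
    E≡1 = - (u * E) , modulo (# 1) E-inverse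
      (solve 2 (λ u E → E :- (:# 1 :+ :# 2 :* :- (u :* E)) := :# 1 :* (E :* (:# 1 :+ :# 2 :* u) :- :# 1)) refl u E)

    E²≡1-4[u+u²] : E * E ≡ # 1 - # 4 * (u + u * u) [mod 16 ]
    E²≡1-4[u+u²] = (u + u * u) * (u + u * u) * (E * E) ,
      modulo ((# 1 - # 4 * (u + u * u)) * (E * (# 1 + # 2 * u) + # 1)) E-inverse
      (solve 2 (λ u E → E :* E :- (:# 1 :- :# 4 :* (u :+ u :* u) :+ :# 16 :* ((u :+ u :* u) :* (u :+ u :* u) :* (E :* E)))
         := (:# 1 :- :# 4 :* (u :+ u :* u)) :* (E :* (:# 1 :+ :# 2 :* u) :+ :# 1) :* (E :* (:# 1 :+ :# 2 :* u) :- :# 1)) refl u E)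

    E²≡1 : E * E ≡ # 1 [mod 4 ]
    E²≡1 = mod-trans (mod-* E≡1-2u E≡1-2u) (u * u - u ,
      solve 1 (λ u → (:# 1 :- :# 2 :* u) :* (:# 1 :- :# 2 :* u) := :# 1 :+ :# 4 :* (u :* u :- u)) refl u)

    2x-mod-4 : ∀ {x y} → x ≡ y [mod 2 ] → # 2 * x ≡ # 2 * y [mod 4 ]
    2x-mod-4 = mod-scale 2

    -- Sorted by behaviour at odd exponents: the last bracket is a series in q². The products of θ
    -- or θ² with `u` carry a factor 2, so that `u≡v` modulo 2 suffices to rewrite them.
    Eκ-mod-4 : E * κ ≡ θ + θ * θ + # 2 * (θ * v) + (# 2 * (v * v) - (u + # 3 * (u * u) + # 2 * (u * u * u))) [mod 4 ]
    Eκ-mod-4 = mod-trans (≈⇒mod (solve 2 (λ e x → e :* (x :* (e :* e)) := x :* (e :* (e :* e))) refl E _))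
      (mod-trans (mod-* mod-refl E³≡)
      (mod-trans (≈⇒mod (solve 2 (λ θ u → (θ :+ θ :* θ :- u :- u :* u) :* (:# 1 :+ :# 2 :* u)
          := θ :+ θ :* θ :+ :# 2 :* (θ :* u) :+ (:# 2 :* (θ :* θ :* u) :- (u :+ :# 3 :* (u :* u) :+ :# 2 :* (u :* u :* u)))) refl θ u))
      (mod-+ (mod-+ mod-refl (2x-mod-4 (mod-* mod-refl u≡v)))
             (mod-- (2x-mod-4 (mod-* θ²≡v u≡v)) mod-refl))))
      where
      E³≡ : E * (E * E) ≡ # 1 + # 2 * u [mod 4 ]
      E³≡ = mod-trans (mod-* E≡1-2u E²≡1) (- u , solve 1 (λ u → (:# 1 :- :# 2 :* u) :* :# 1 := :# 1 :+ :# 2 :* u :+ :# 4 :* :- u) refl u)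

    mod-4⇒mod-2 : ∀ {x y} → x ≡ y [mod 4 ] → x ≡ y [mod 2 ]
    mod-4⇒mod-2 {x} {y} (k , h) = # 2 * k , trans h (solve 2 (λ y k → y :+ :# 4 :* k := y :+ :# 2 :* (:# 2 :* k)) refl y k)

    -- Modulo 2, `κ` is θ plus a series in q². Squaring loses the cross term, and θ² ≡ v is again a
    -- series in q², so nothing reaches an odd exponent.
    Eκ²-mod-2 : E * (κ * κ) ≡ v + (v - u - u * u) * (v - u - u * u) [mod 2 ]
    Eκ²-mod-2 = mod-trans (mod-* E≡1 (mod-* κ≡ κ≡))
      (mod-trans (θ * (v - u - u * u) , solve 2 (λ θ e → :# 1 :* ((θ :+ e) :* (θ :+ e)) := θ :* θ :+ e :* e :+ :# 2 :* (θ :* e)) refl θ (v - u - u * u))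
                 (mod-+ θ²≡v mod-refl))
      where
      κ≡ : κ ≡ θ + (v - u - u * u) [mod 2 ]
      κ≡ = mod-trans (mod-* (mod-- (mod-- (mod-+ mod-refl θ²≡v) mod-refl) mod-refl) (mod-4⇒mod-2 E²≡1))
        (≈⇒mod (solve 3 (λ θ v u → (θ :+ v :- u :- u :* u) :* :# 1 := θ :+ (v :- u :- u :* u)) refl θ v u))

    u+u²≡v+w : u + u * u ≡ v + w [mod 2 ]
    u+u²≡v+w = mod-+ u≡v (mod-trans (mod-* u≡v u≡v) v²≡w)

    -- E² is the inverse of 1 + 4 (u + u²), so θ meets `u + u * u` only with the factor 8, where its
    -- value `v + w` modulo 2 is enough.
    φE²-mod-16 : φ * (E * E) ≡ # 1 - # 4 * (u + u * u) + # 2 * θ - # 8 * (θ * (v + w)) [mod 16 ]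
    φE²-mod-16 = mod-trans (mod-* mod-refl E²≡1-4[u+u²])
      (mod-trans (≈⇒mod (solve 2 (λ θ x → (:# 1 :+ :# 2 :* θ) :* (:# 1 :- :# 4 :* x) := :# 1 :- :# 4 :* x :+ :# 2 :* θ :- :# 8 :* (θ :* x)) refl θ (u + u * u)))
                 (mod-- mod-refl (mod-scale 8 (mod-* mod-refl u+u²≡v+w))))

    -- Modulo 4 is enough because `O^[2β+1]*E` multiplies this by 4. The two occurrences of θ v
    -- cancel, so r(N) enters the odd case only through `φE²-mod-16`.
    κφE²-mod-4 : κ * (φ * (E * E)) ≡ θ + # 3 * (θ * θ) - (u + u * u) + # 2 * (θ * v) - # 2 * (θ * (v + w)) [mod 4 ]
    κφE²-mod-4 = mod-trans (mod-* (mod-* mod-refl E²≡1) (mod-* mod-refl E²≡1))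
      (mod-trans (≈⇒mod (solve 2 (λ θ u → (θ :+ θ :* θ :- u :- u :* u) :* :# 1 :* ((:# 1 :+ :# 2 :* θ) :* :# 1)
                           := θ :+ :# 3 :* (θ :* θ) :- (u :+ u :* u) :+ :# 2 :* (θ :* (θ :* θ)) :- :# 2 :* (θ :* (u :+ u :* u))) refl θ u))
                 (mod-- (mod-+ mod-refl (2x-mod-4 (mod-* mod-refl θ²≡v))) (2x-mod-4 (mod-* mod-refl u+u²≡v+w))))

    1+4κ-pow : ∀ t → (# 1 + # 4 * κ) ^ t ≡ # 1 + # 4 * (# t * κ) [mod 16 ]
    1+4κ-pow zero    = ≈⇒mod (trans (sym #1≈1) (solve 1 (λ k → :# 1 := :# 1 :+ :# 4 :* (:# 0 :* k)) refl κ))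
    1+4κ-pow (suc t) = mod-trans (mod-* mod-refl (1+4κ-pow t))
      (# t * (κ * κ) , trans
        (solve 2 (λ k t → (:# 1 :+ :# 4 :* k) :* (:# 1 :+ :# 4 :* (t :* k)) := :# 1 :+ :# 4 :* ((:# 1 :+ t) :* k) :+ :# 16 :* (t :* (k :* k))) refl κ (# t))
        (+-congʳ (+-congˡ (*-congˡ (*-congʳ (sym (+-homo (+ 1) (+ t))))))))

    -- Squaring 1 + 4·2^i·Z gives 1 + 4·2^(i+1)·(Z + 2·2^i·Z²), and Z² ≡ (α κ)² modulo 2.
    1+4κ-pow-2^ : ∀ α i → ∃ λ c → ∃ λ Z →
      (# 1 + # 4 * κ) ^ (2 ℕ.^ i ℕ.* α) ≈ # 1 + # 4 * # (2 ℕ.^ i) * Z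
      × Z ≡ # α * κ + # 2 * # c * (κ * κ) [mod 4 ]
    1+4κ-pow-2^ α zero with 1+4κ-pow α
    ... | k , h = 0 , # α * κ + # 4 * k
      , trans (^-congʳ _ (ℕ.*-identityˡ α)) (trans h
          (solve 2 (λ x k → :# 1 :+ :# 4 :* x :+ :# 16 :* k := :# 1 :+ :# 4 :* :# 1 :* (x :+ :# 4 :* k)) refl (# α * κ) k))
      , k , solve 3 (λ x κ k → x :+ :# 4 :* k := x :+ :# 2 :* :# 0 :* (κ :* κ) :+ :# 4 :* k) refl (# α * κ) κ k
    1+4κ-pow-2^ α (suc i) with 1+4κ-pow-2^ α i
    ... | c , Z , h , Z≡ = c ℕ.+ 2 ℕ.^ i ℕ.* (α ℕ.* α) , Z + # 2 * (P * (Z * Z)) , pow , Z′≡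
      where
      P : Carrier
      P = # (2 ℕ.^ i)

      #* : ∀ m n → # (m ℕ.* n) ≈ # m * # n
      #* m n = trans (reflexive (≡.cong ι (ℤ.pos-* m n))) (*-homo (+ m) (+ n))

      pow : (# 1 + # 4 * κ) ^ (2 ℕ.^ suc i ℕ.* α) ≈ # 1 + # 4 * # (2 ℕ.^ suc i) * (Z + # 2 * (P * (Z * Z)))
      pow = begin
        (# 1 + # 4 * κ) ^ (2 ℕ.^ suc i ℕ.* α)
          ≡⟨ ≡.cong ((# 1 + # 4 * κ) ^_) (ℕ-Solver.solve 2 (λ x a → ℕ-Solver.con 2 ℕ-Solver.:* x ℕ-Solver.:* a ℕ-Solver.:= x ℕ-Solver.:* a ℕ-Solver.:+ x ℕ-Solver.:* a) ≡.refl (2 ℕ.^ i) α) ⟩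
        (# 1 + # 4 * κ) ^ (2 ℕ.^ i ℕ.* α ℕ.+ 2 ℕ.^ i ℕ.* α)
          ≈⟨ ^-homo-* (# 1 + # 4 * κ) (2 ℕ.^ i ℕ.* α) (2 ℕ.^ i ℕ.* α) ⟩
        (# 1 + # 4 * κ) ^ (2 ℕ.^ i ℕ.* α) * (# 1 + # 4 * κ) ^ (2 ℕ.^ i ℕ.* α)
          ≈⟨ *-cong h h ⟩
        (# 1 + # 4 * P * Z) * (# 1 + # 4 * P * Z)
          ≈⟨ solve 2 (λ P Z → (:# 1 :+ :# 4 :* P :* Z) :* (:# 1 :+ :# 4 :* P :* Z) := :# 1 :+ :# 4 :* (:# 2 :* P) :* (Z :+ :# 2 :* (P :* (Z :* Z)))) refl P Z ⟩
        # 1 + # 4 * (# 2 * P) * (Z + # 2 * (P * (Z * Z)))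
          ≈⟨ +-congˡ (*-congʳ (*-congˡ (#* 2 (2 ℕ.^ i)))) ⟨
        # 1 + # 4 * # (2 ℕ.^ suc i) * (Z + # 2 * (P * (Z * Z))) ∎

      Z≡ακ : Z ≡ # α * κ [mod 2 ]
      Z≡ακ = mod-trans (mod-4⇒mod-2 Z≡) (# c * (κ * κ) , +-congˡ (*-assoc _ _ _))

      Z′≡ : Z + # 2 * (P * (Z * Z)) ≡ # α * κ + # 2 * # (c ℕ.+ 2 ℕ.^ i ℕ.* (α ℕ.* α)) * (κ * κ) [mod 4 ]
      Z′≡ = mod-trans (mod-+ Z≡ (2x-mod-4 (mod-* mod-refl (mod-* Z≡ακ Z≡ακ)))) (≈⇒mod (begin
        # α * κ + # 2 * # c * (κ * κ) + # 2 * (P * (# α * κ * (# α * κ)))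
          ≈⟨ solve 4 (λ a k c P → a :* k :+ :# 2 :* c :* (k :* k) :+ :# 2 :* (P :* (a :* k :* (a :* k))) := a :* k :+ :# 2 :* (c :+ P :* (a :* a)) :* (k :* k)) refl (# α) κ (# c) P ⟩
        # α * κ + # 2 * (# c + P * (# α * # α)) * (κ * κ)
          ≈⟨ +-congˡ (*-congʳ (*-congˡ (trans (+-homo (+ c) (+ (2 ℕ.^ i ℕ.* (α ℕ.* α)))) (+-congˡ (trans (#* (2 ℕ.^ i) (α ℕ.* α)) (*-congˡ (#* α α))))))) ⟨
        # α * κ + # 2 * # (c ℕ.+ 2 ℕ.^ i ℕ.* (α ℕ.* α)) * (κ * κ) ∎))

    -- The leading `E` is a series in q² and vanishes at odd exponents. The rest has the factor 4 ·
    -- 2^m, which leaves `E * Z` to be found modulo 4.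
    O^[2^[1+m]α]*E : ∀ α m → ∃ λ c → ∃ λ Z →
      O ^ (2 ℕ.^ suc m ℕ.* α) * E ≈ E + # 4 * (# (2 ℕ.^ m) * (E * Z))
      × E * Z ≡ # α * (E * κ) + # 2 * (# c * (E * (κ * κ))) [mod 4 ]
    O^[2^[1+m]α]*E α m with 1+4κ-pow-2^ α m
    ... | c , Z , h , Z≡ = c , Z , expansion , mod-trans (mod-* mod-refl Z≡) (≈⇒mod
      (solve 4 (λ E a k c → E :* (a :* k :+ :# 2 :* c :* (k :* k)) := a :* (E :* k) :+ :# 2 :* (c :* (E :* (k :* k)))) refl E (# α) κ (# c)))
      where
      expansion : O ^ (2 ℕ.^ suc m ℕ.* α) * E ≈ E + # 4 * (# (2 ℕ.^ m) * (E * Z))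
      expansion = begin
        O ^ (2 ℕ.^ suc m ℕ.* α) * E
          ≡⟨ ≡.cong (λ k → O ^ k * E) (ℕ.*-assoc 2 (2 ℕ.^ m) α) ⟩
        O ^ (2 ℕ.* (2 ℕ.^ m ℕ.* α)) * E
          ≈⟨ *-congʳ (^-assocʳ O 2 (2 ℕ.^ m ℕ.* α)) ⟨
        (O ^ 2) ^ (2 ℕ.^ m ℕ.* α) * E
          ≈⟨ *-congʳ (trans (^-congˡ (2 ℕ.^ m ℕ.* α) (trans (*-congˡ (*-identityʳ O)) O²≈1+4κ)) h) ⟩
        (# 1 + # 4 * # (2 ℕ.^ m) * Z) * E
          ≈⟨ solve 3 (λ P Z E → (:# 1 :+ :# 4 :* P :* Z) :* E := E :+ :# 4 :* (P :* (E :* Z))) refl (# (2 ℕ.^ m)) Z E ⟩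
        E + # 4 * (# (2 ℕ.^ m) * (E * Z)) ∎

    -- The unpaired factor O is φE, and with the E of the even parts it becomes φE².
    O^[2β+1]*E : ∀ β → O ^ (2 ℕ.* β ℕ.+ 1) * E ≡ φ * (E * E) + # 4 * (# β * (κ * (φ * (E * E)))) [mod 16 ]
    O^[2β+1]*E β = mod-trans (≈⇒mod expansion) (mod-trans (mod-* (1+4κ-pow β) mod-refl) (≈⇒mod
      (solve 3 (λ b k y → (:# 1 :+ :# 4 :* (b :* k)) :* y := y :+ :# 4 :* (b :* (k :* y))) refl (# β) κ (φ * (E * E)))))
      where
      expansion : O ^ (2 ℕ.* β ℕ.+ 1) * E ≈ (# 1 + # 4 * κ) ^ β * (φ * (E * E))
      expansion = begin
        O ^ (2 ℕ.* β ℕ.+ 1) * E            ≈⟨ *-congʳ (^-homo-* O (2 ℕ.* β) 1) ⟩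
        O ^ (2 ℕ.* β) * (O * 1#) * E
          ≈⟨ *-congʳ (*-cong (trans (sym (^-assocʳ O 2 β)) (^-congˡ β (trans (*-congˡ (*-identityʳ O)) O²≈1+4κ)))
                             (trans (*-identityʳ O) (sym θE≈O))) ⟩
        (# 1 + # 4 * κ) ^ β * (φ * E) * E  ≈⟨ solve 3 (λ x φ E → x :* (φ :* E) :* E := x :* (φ :* (E :* E))) refl ((# 1 + # 4 * κ) ^ β) φ E ⟩
        (# 1 + # 4 * κ) ^ β * (φ * (E * E)) ∎

  -- The generating function of coloured overpartitions

  module GeneratingFunctions (q : Carrier) where

    gf : ∀ {A : Set} → (A → ℕ) → List A → Carrier
    gf w []       = # 0
    gf w (x ∷ xs) = q ^ w x + gf w xs

    gf-++ : ∀ {A : Set} (w : A → ℕ) xs ys → gf w (xs ++ ys) ≈ gf w xs + gf w ys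
    gf-++ w []       ys = solve 1 (λ y → y := :# 0 :+ y) refl (gf w ys)
    gf-++ w (x ∷ xs) ys = trans (+-congˡ (gf-++ w xs ys)) (sym (+-assoc _ _ _))

    gf-map : ∀ {A B : Set} {w : A → ℕ} {w′ : B → ℕ} (f : A → B) {c} →
             (∀ x → w′ (f x) ≡ c ℕ.+ w x) → ∀ xs → gf w′ (map f xs) ≈ q ^ c * gf w xs
    gf-map f {c} h []       = solve 1 (λ x → :# 0 := x :* :# 0) refl (q ^ c)
    gf-map {w = w} f {c} h (x ∷ xs) = trans
      (+-cong (trans (^-congʳ q (h x)) (^-homo-* q c (w x))) (gf-map f h xs))
      (sym (distribˡ _ _ _))

    gf-cartesianProductWith : ∀ {A B C : Set} {wA : A → ℕ} {wB : B → ℕ} {wC : C → ℕ} (f : A → B → C) →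
      (∀ a b → wC (f a b) ≡ wA a ℕ.+ wB b) → ∀ as bs →
      gf wC (cartesianProductWith f as bs) ≈ gf wA as * gf wB bs
    gf-cartesianProductWith {wB = wB} f h []       bs = sym (#0*-zero (gf wB bs))
    gf-cartesianProductWith {wA = wA} {wB} f h (a ∷ as) bs = trans (gf-++ _ (map (f a) bs) _)
      (trans (+-cong (gf-map (f a) (h a) bs) (gf-cartesianProductWith f h as bs))
             (sym (distribʳ (gf wB bs) (q ^ wA a) (gf wA as))))

    gf-applyUpTo : ∀ {A : Set} {w : A → ℕ} {f g} → (∀ k → q ^ w (f k) ≈ g (suc k)) → ∀ n → gf w (applyUpTo f n) ≈ sum n g
    gf-applyUpTo h zero    = refl
    gf-applyUpTo {w = w} {f} {g} h (suc n) = begin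
      gf w (applyUpTo f (suc n))               ≡⟨ ≡.cong (gf w) (applyUpTo-∷ʳ f n) ⟨
      gf w (applyUpTo f n ∷ʳ f n)              ≈⟨ gf-++ w (applyUpTo f n) (f n ∷ []) ⟩
      gf w (applyUpTo f n) + (q ^ w (f n) + # 0) ≈⟨ +-cong (gf-applyUpTo h n) (trans (solve 1 (λ x → x :+ :# 0 := x) refl _) (h n)) ⟩
      sum n g + g (suc n) ∎

    listProduct : ∀ {A : Set} → (A → Carrier) → List A → Carrier
    listProduct f []       = # 1
    listProduct f (x ∷ xs) = f x * listProduct f xs

    listProduct-++ : ∀ {A : Set} (f : A → Carrier) xs ys → listProduct f (xs ++ ys) ≈ listProduct f xs * listProduct f ys
    listProduct-++ f []       ys = sym (#1*-identity _)
    listProduct-++ f (x ∷ xs) ys = trans (*-congˡ (listProduct-++ f xs ys)) (sym (*-assoc _ _ _))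

    listProduct-map : ∀ {A B : Set} (f : B → Carrier) (g : A → B) xs → listProduct f (map g xs) ≡ listProduct (f ∘ g) xs
    listProduct-map f g []       = ≡.refl
    listProduct-map f g (x ∷ xs) = ≡.cong (f (g x) *_) (listProduct-map f g xs)

    listProduct-const : ∀ {A : Set} y (xs : List A) → listProduct (λ _ → y) xs ≈ y ^ length xs
    listProduct-const y []       = #1≈1
    listProduct-const y (x ∷ xs) = *-congˡ (listProduct-const y xs)

    listProduct-concatMap : ∀ {A B : Set} (f : B → Carrier) (g : A → List B) xs →
      listProduct f (concatMap g xs) ≈ listProduct (λ x → listProduct f (g x)) xs
    listProduct-concatMap f g []       = refl
    listProduct-concatMap f g (x ∷ xs) = trans (listProduct-++ f (g x) (concatMap g xs)) (*-congˡ (listProduct-concatMap f g xs))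

    listProduct-applyUpTo : ∀ {f : ℕ → Carrier} n → listProduct f (applyUpTo suc n) ≈ product n f
    listProduct-applyUpTo zero    = refl
    listProduct-applyUpTo {f} (suc n) = begin
      listProduct f (applyUpTo suc (suc n))     ≡⟨ ≡.cong (listProduct f) (applyUpTo-∷ʳ suc n) ⟨
      listProduct f (applyUpTo suc n ∷ʳ suc n)  ≈⟨ listProduct-++ f (applyUpTo suc n) (suc n ∷ []) ⟩
      listProduct f (applyUpTo suc n) * (f (suc n) * # 1)
        ≈⟨ *-cong (listProduct-applyUpTo n) (solve 1 (λ x → x :* :# 1 := x) refl (f (suc n))) ⟩
      product n f * f (suc n) ∎

    listProduct-cong : ∀ {A : Set} {f g : A → Carrier} → (∀ x → f x ≈ g x) → ∀ xs → listProduct f xs ≈ listProduct g xs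
    listProduct-cong h []       = refl
    listProduct-cong h (x ∷ xs) = *-cong (h x) (listProduct-cong h xs)

    module OverpartitionProduct (N : ℕ) (q-nilpotent : q ^ suc N ≈ # 0) where
      open Truncation N
      open ThetaQuotients N q q-nilpotent using (O; E; odd-factor; even-factor)

      -- `absent` contributes 1, and plain and overlined runs of 1 to N copies contribute one
      -- truncated geometric sum each. This is the origin of (1 + y)/(1 - y).
      gf-occurrences : ∀ j → gf (λ o → multiplicity o ℕ.* j) (occurrences N) ≈ cayley (q ^ j)
      gf-occurrences j = begin
        1# + gf wt (map plain (upTo N) ++ map overlined (upTo N))
          ≈⟨ +-cong (sym #1≈1) (gf-++ wt (map plain (upTo N)) (map overlined (upTo N))) ⟩
        # 1 + (gf wt (map plain (upTo N)) + gf wt (map overlined (upTo N)))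
          ≈⟨ +-congˡ (+-cong (run plain (λ _ → ≡.refl)) (run overlined (λ _ → ≡.refl))) ⟩
        # 1 + (geometric (q ^ j) + geometric (q ^ j))
          ≈⟨ solve 1 (λ g → :# 1 :+ (g :+ g) := :# 1 :+ :# 2 :* g) refl (geometric (q ^ j)) ⟩
        cayley (q ^ j) ∎
        where
        wt : Occurrence → ℕ
        wt o = multiplicity o ℕ.* j

        run : (f : ℕ → Occurrence) → (∀ k → multiplicity (f k) ≡ suc k) → gf wt (map f (upTo N)) ≈ geometric (q ^ j)
        run f h = begin
          gf wt (map f (upTo N))
            ≈⟨ gf-map {w = λ k → suc k ℕ.* j} f {0} (λ k → ≡.cong (ℕ._* j) (h k)) (upTo N) ⟩
          1# * gf (λ k → suc k ℕ.* j) (upTo N)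
            ≈⟨ *-identityˡ _ ⟩
          gf (λ k → suc k ℕ.* j) (upTo N)
            ≈⟨ gf-applyUpTo (λ k → trans (^-congʳ q (ℕ.*-comm (suc k) j)) (sym (^-assocʳ q j (suc k)))) N ⟩
          geometric (q ^ j) ∎

      gf-assignments : ∀ {s} (ps : List (Part s)) → gf weight (assignments N ps) ≈ listProduct (λ p → cayley (q ^ size p)) ps
      gf-assignments []       = trans (+-congʳ (sym #1≈1)) (solve 0 (:# 1 :+ :# 0 := :# 1) refl)
      gf-assignments (p ∷ ps) = trans
        (gf-cartesianProductWith {wA = λ o → multiplicity o ℕ.* size p} {wB = weight} _∷_ (λ _ _ → ≡.refl) (occurrences N) (assignments N ps))
        (*-cong (gf-occurrences (size p)) (gf-assignments ps))

      -- Assignments of every weight take part, so the sum factors over the parts; the condition on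
      -- the weight returns when the coefficient of q^N is taken.
      gf-overpartitions : ∀ s → gf weight (assignments N (parts s N)) ≈ O ^ s * E
      gf-overpartitions s = begin
        gf weight (assignments N (parts s N))
          ≈⟨ gf-assignments (parts s N) ⟩
        listProduct part-factor (parts s N)
          ≈⟨ listProduct-concatMap part-factor (λ j → map (j ,_) (allFin (colours s j))) (applyUpTo suc N) ⟩
        listProduct (λ j → listProduct part-factor (map (j ,_) (allFin (colours s j)))) (applyUpTo suc N)
          ≈⟨ listProduct-cong colour-product (applyUpTo suc N) ⟩
        listProduct (λ j → cayley (q ^ j) ^ colours s j) (applyUpTo suc N)
          ≈⟨ listProduct-applyUpTo N ⟩
        product N (λ j → cayley (q ^ j) ^ colours s j)
          ≈⟨ product-cong N (λ k → factor (suc k)) ⟩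
        product N (λ j → odd-factor j ^ s * even-factor j)
          ≈⟨ product-* N _ _ ⟩
        product N (λ j → odd-factor j ^ s) * E
          ≈⟨ *-congʳ (product-^ N odd-factor s) ⟩
        O ^ s * E ∎
        where
        part-factor : Part s → Carrier
        part-factor p = cayley (q ^ size p)

        colour-product : ∀ j → listProduct part-factor (map (j ,_) (allFin (colours s j))) ≈ cayley (q ^ j) ^ colours s j
        colour-product j = begin
          listProduct part-factor (map (j ,_) (allFin (colours s j)))  ≡⟨ listProduct-map part-factor (j ,_) (allFin (colours s j)) ⟩
          listProduct (λ _ → cayley (q ^ j)) (allFin (colours s j))    ≈⟨ listProduct-const (cayley (q ^ j)) (allFin (colours s j)) ⟩
          cayley (q ^ j) ^ length (allFin (colours s j))               ≡⟨ ≡.cong (cayley (q ^ j) ^_) (length-tabulate {n = colours s j} (λ i → i)) ⟩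
          cayley (q ^ j) ^ colours s j                                 ∎

        1^ : ∀ n → # 1 ^ n ≈ # 1
        1^ zero    = sym #1≈1
        1^ (suc n) = trans (#1*-identity _) (1^ n)

        factor : ∀ j → cayley (q ^ j) ^ colours s j ≈ odd-factor j ^ s * even-factor j
        factor j with odd? j
        ... | true  = solve 1 (λ x → x := x :* :# 1) refl _
        ... | false = trans (*-identityʳ _) (sym (trans (*-congʳ (1^ s)) (#1*-identity _)))

-- Congruences for the coefficients

module TruncatedSeries (N : ℕ) where
  open PowerSeries
  open ℤ-Algebra (truncated N) (const-homomorphism N) using (_^_)

  q : Series
  q zero          = ℤ.0ℤ
  q (suc zero)    = ℤ.1ℤ
  q (suc (suc _)) = ℤ.0ℤ

  open ℤ-Algebra.GeneratingFunctions (truncated N) (const-homomorphism N) q public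

  q*-suc : ∀ f n → (q ⊛ f) (suc n) ≡ f n
  q*-suc f n = ≡.trans (ℤ.+-identityˡ ((q ∘ suc ⊛ f) n)) (≡.trans (⊛-congˡ f tail n) (≡.trans (const-⊛ ℤ.1ℤ f n) (ℤ.*-identityˡ (f n))))
    where
    tail : ∀ i → q (suc i) ≡ const ℤ.1ℤ i
    tail zero    = ≡.refl
    tail (suc _) = ≡.refl

  q^-diagonal : ∀ n → (q ^ n) n ≡ ℤ.1ℤ
  q^-diagonal zero    = ≡.refl
  q^-diagonal (suc n) = ≡.trans (q*-suc (q ^ n) n) (q^-diagonal n)

  q^-off-diagonal : ∀ m n → m ≢ n → (q ^ m) n ≡ ℤ.0ℤ
  q^-off-diagonal zero    zero    m≢n = ⊥-elim (m≢n ≡.refl)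
  q^-off-diagonal zero    (suc n) _   = ≡.refl
  q^-off-diagonal (suc m) zero    _   = ≡.refl
  q^-off-diagonal (suc m) (suc n) m≢n = ≡.trans (q*-suc (q ^ m) n) (q^-off-diagonal m n (m≢n ∘ ≡.cong suc))

  q-nilpotent : q ^ suc N ≃[ N ] const ℤ.0ℤ
  q-nilpotent n n≤N = ≡.trans (q^-off-diagonal (suc N) n (λ e → ℕ.<-irrefl ≡.refl (ℕ.≤-trans (ℕ.≤-reflexive e) n≤N))) (0≡ n)
    where
    0≡ : ∀ n → ℤ.0ℤ ≡ const ℤ.0ℤ n
    0≡ zero    = ≡.refl
    0≡ (suc _) = ≡.refl

  gf-coefficient : ∀ {A : Set} (w : A → ℕ) xs n → gf w xs n ≡ + length (filter (λ x → w x ℕ.≟ n) xs)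
  gf-coefficient w []       zero    = ≡.refl
  gf-coefficient w []       (suc n) = ≡.refl
  gf-coefficient w (x ∷ xs) n with w x ℕ.≟ n
  ... | yes ≡.refl = ≡.trans (≡.cong₂ ℤ._+_ (q^-diagonal (w x)) (gf-coefficient w xs (w x)))
    (≡.cong (λ l → + length l) (≡.sym (filter-accept (λ y → w y ℕ.≟ w x) ≡.refl)))
  ... | no  wx≢n   = ≡.trans (≡.cong₂ ℤ._+_ (q^-off-diagonal (w x) n wx≢n) (gf-coefficient w xs n))
    (≡.trans (ℤ.+-identityˡ _) (≡.cong (λ l → + length l) (≡.sym (filter-reject (λ y → w y ℕ.≟ n) wx≢n))))

squareForm : ℕ → ℕ → ℕ × ℕ → ℕ
squareForm a b (i , j) = a ℕ.* (i ℕ.* i) ℕ.+ b ℕ.* (j ℕ.* j)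

representations : ℕ → ℕ → List (ℕ × ℕ)
representations b N = filter (λ ij → squareForm 1 b ij ℕ.≟ N) (cartesianProduct (applyUpTo suc N) (applyUpTo suc N))

module Coefficients (N : ℕ) where
  open PowerSeries
  open TruncatedSeries N
  open ℤ-Algebra (truncated N) (const-homomorphism N)
  open ThetaQuotients N q q-nilpotent
  open Truncation N using (cayley)
  open OverpartitionProduct N q-nilpotent using (gf-overpartitions)

  record VanishesAt (b : Bool) (f : Series) : Set where
    constructor vanishes
    field vanish : ∀ n → odd? n ≡ b → f n ≡ ℤ.0ℤ
  open VanishesAt

  Even : Series → Set
  Even = VanishesAt true

  -- The recursion of the product passes from `f` to `f ∘ suc`, which exchanges the parities. The
  -- induction therefore needs both values of `b`, though `g` stays even.
  even-⊛ : ∀ {b f g} → VanishesAt b f → Even g → VanishesAt b (f * g)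
  even-⊛ {b} {f} {g} hf hg = vanishes (go {b} {f} (vanish hf))
    where
    not-not : ∀ b → not (not b) ≡ b
    not-not true  = ≡.refl
    not-not false = ≡.refl

    head : ∀ {f} b n → (∀ n → odd? n ≡ b → f n ≡ ℤ.0ℤ) → odd? n ≡ b → f 0 ℤ.* g n ≡ ℤ.0ℤ
    head {f} true  n _  e = ≡.trans (≡.cong (f 0 ℤ.*_) (vanish hg n e)) (ℤ.*-zeroʳ (f 0))
    head     false n hf _ = ≡.cong (ℤ._* g n) (hf 0 ≡.refl)

    go : ∀ {b f} → (∀ n → odd? n ≡ b → f n ≡ ℤ.0ℤ) → ∀ n → odd? n ≡ b → (f ⊛ g) n ≡ ℤ.0ℤ
    go {b} {f} hf zero    e = head {f} b 0 hf e
    go {b} {f} hf (suc n) e = ≡.cong₂ ℤ._+_ (head {f} b (suc n) hf e)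
      (go {not b} {f ∘ suc} (λ m e′ → hf (suc m) (≡.trans (odd?-suc m) (≡.trans (≡.cong not e′) (not-not b)))) n
        (not-injective (≡.trans (≡.sym (odd?-suc n)) (≡.trans e (≡.sym (not-not b))))))

  even-⊕ : ∀ {f g} → Even f → Even g → Even (f + g)
  even-⊕ hf hg = vanishes λ n e → ≡.cong₂ ℤ._+_ (vanish hf n e) (vanish hg n e)

  even-⊖ : ∀ {f} → Even f → Even (- f)
  even-⊖ hf = vanishes λ n e → ≡.cong ℤ.-_ (vanish hf n e)

  even-- : ∀ {f g} → Even f → Even g → Even (f - g)
  even-- hf hg = even-⊕ hf (even-⊖ hg)

  even-const : ∀ c → Even (const c)
  even-const c = vanishes λ { (suc n) _ → ≡.refl }

  even-# : ∀ n → Even (# n)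
  even-# n = even-const (+ n)

  even-^ : ∀ {f} n → Even f → Even (f ^ n)
  even-^ zero    _ = even-const ℤ.1ℤ
  even-^ (suc n) h = even-⊛ h (even-^ n h)

  even-sum : ∀ {f} n → (∀ k → Even (f k)) → Even (sum n f)
  even-sum zero    _ = even-# 0
  even-sum (suc n) h = even-⊕ (even-sum n h) (h (suc n))

  even-product : ∀ {f} n → (∀ k → Even (f k)) → Even (product n f)
  even-product zero    _ = even-# 1
  even-product (suc n) h = even-⊛ (even-product n h) (h (suc n))

  even-q^ : ∀ m → odd? m ≡ false → Even (q ^ m)
  even-q^ m e = vanishes λ n o → q^-off-diagonal m n λ { ≡.refl → true≢false (≡.trans (≡.sym o) e) }
    where
    true≢false : true ≢ false
    true≢false ()

  E-even : Even E
  E-even = even-product N factor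
    where
    factor : ∀ j → Even (even-factor j)
    factor j with odd? j in e
    ... | true  = even-# 1
    ... | false = even-⊕ (even-# 1) (even-⊛ (even-# 2) (even-sum N (λ k → even-^ k (even-q^ j e))))

  u-even : Even u
  u-even = even-sum N (λ k → even-^ k (even-⊖ (even-^ k (even-q^ 2 ≡.refl))))

  v-even : Even v
  v-even = even-sum N (λ k → even-q^ (2 ℕ.* (k ℕ.* k)) (odd?-2* (k ℕ.* k)))

  infix 4 _∣[q^N]_
  record _∣[q^N]_ (c : ℕ) (f : Series) : Set where
    constructor coefficient
    field divisible : + c ∣ℤ f N
  open _∣[q^N]_

  #*-coefficient : ∀ c f → (# c * f) N ≡ + c ℤ.* f N
  #*-coefficient c f = const-⊛ (+ c) f N

  ∣-+ : ∀ {c f g} → c ∣[q^N] f → c ∣[q^N] g → c ∣[q^N] f + g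
  ∣-+ (coefficient d) (coefficient e) = coefficient (ℤ∣.∣m∣n⇒∣m+n d e)

  ∣-- : ∀ {c f g} → c ∣[q^N] f → c ∣[q^N] g → c ∣[q^N] f - g
  ∣-- (coefficient d) (coefficient e) = coefficient (ℤ∣.∣m∣n⇒∣m-n d e)

  ∣-≈ : ∀ {c f g} → f ≈ g → c ∣[q^N] g → c ∣[q^N] f
  ∣-≈ {c} h (coefficient d) = coefficient (≡.subst (+ c ∣ℤ_) (≡.sym (h N ℕ.≤-refl)) d)

  ∣-mod : ∀ {c f g} → f ≡ g [mod c ] → c ∣[q^N] g → c ∣[q^N] f
  ∣-mod {c} {f} {g} (k , h) d = ∣-≈ {g = g + # c * k} h (∣-+ {f = g} {g = # c * k} d
    (coefficient (ℤ∣.divides (k N) (≡.trans (#*-coefficient c k) (ℤ.*-comm (+ c) (k N))))))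

  ∣-scale : ∀ d {c f} → c ∣[q^N] f → d ℕ.* c ∣[q^N] # d * f
  ∣-scale d {c} {f} (coefficient h) =
    coefficient (≡.subst₂ _∣ℤ_ (≡.sym (ℤ.pos-* d c)) (≡.sym (#*-coefficient d f)) (ℤ∣.*-monoʳ-∣ (+ d) h))

  ∣-#* : ∀ d {c f} → c ∣[q^N] f → c ∣[q^N] # d * f
  ∣-#* d {c} {f} (coefficient h) = coefficient (≡.subst (+ c ∣ℤ_) (≡.sym (#*-coefficient d f)) (ℤ∣.∣n⇒∣m*n (+ d) h))

  ∣-zero : ∀ {c f} → f N ≡ ℤ.0ℤ → c ∣[q^N] f
  ∣-zero {c} h = coefficient (≡.subst (+ c ∣ℤ_) (≡.sym h) (ℤ∣.divides ℤ.0ℤ ≡.refl))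

  box : List (ℕ × ℕ)
  box = cartesianProduct (applyUpTo suc N) (applyUpTo suc N)

  squares-product : ∀ b → sum N (λ k → q ^ (k ℕ.* k)) * sum N (λ k → q ^ (b ℕ.* (k ℕ.* k))) ≈ gf (squareForm 1 b) box
  squares-product b = sym (trans
    (gf-cartesianProductWith {wA = λ i → i ℕ.* i} {wB = λ j → b ℕ.* (j ℕ.* j)} _,_
      (λ i j → ≡.cong (ℕ._+ b ℕ.* (j ℕ.* j)) (ℕ.+-identityʳ (i ℕ.* i))) (applyUpTo suc N) (applyUpTo suc N))
    (*-cong (gf-applyUpTo {w = λ i → i ℕ.* i} {g = λ k → q ^ (k ℕ.* k)} (λ _ → refl) N)
            (gf-applyUpTo {w = λ j → b ℕ.* (j ℕ.* j)} {g = λ k → q ^ (b ℕ.* (k ℕ.* k))} (λ _ → refl) N)))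

  squares-coefficient : ∀ b → (sum N (λ k → q ^ (k ℕ.* k)) * sum N (λ k → q ^ (b ℕ.* (k ℕ.* k)))) N
                        ≡ + length (representations b N)
  squares-coefficient b = ≡.trans (squares-product b N ℕ.≤-refl) (gf-coefficient (squareForm 1 b) box N)

  no-representations : ∀ b → (∀ i j → squareForm 1 b (i , j) ≢ N) → representations b N ≡ []
  no-representations b h = filter-none (λ ij → squareForm 1 b ij ℕ.≟ N) {xs = box} (All.tabulate (λ {ij} _ → h (proj₁ ij) (proj₂ ij)))

  ā-coefficient : ∀ s → + ā s N ≡ (O ^ s * E) N
  ā-coefficient s = ≡.trans (≡.sym (gf-coefficient weight (assignments N (parts s N)) N)) (gf-overpartitions s N ℕ.≤-refl)

  ā-divisible : ∀ c s → c ∣[q^N] O ^ s * E → c ∣ ā s N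
  ā-divisible c s (coefficient h) = ℤ∣.∣⇒∣ᵤ (≡.subst (+ c ∣ℤ_) (≡.sym (ā-coefficient s)) h)

  module _ (N-odd : odd? N ≡ true)
           (not-two-squares : ∀ i j → squareForm 1 1 (i , j) ≢ N)
           (even-representations : 2 ∣ length (representations 2 N)) where

    even⇒∣ : ∀ {c f} → Even f → c ∣[q^N] f
    even⇒∣ h = ∣-zero (vanish h N N-odd)

    θ-∣ : ∀ {c} → c ∣[q^N] θ
    θ-∣ = ∣-zero (zero-sum N)
      where
      zero-sum : ∀ n → sum n (λ k → q ^ (k ℕ.* k)) N ≡ ℤ.0ℤ
      zero-sum zero    = vanish (even-# 0) N N-odd
      -- Being no sum of two squares, with j = 0 allowed, includes not being a square.
      zero-sum (suc n) = ≡.cong₂ ℤ._+_ (zero-sum n) (q^-off-diagonal (suc n ℕ.* suc n) N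
        (λ e → not-two-squares (suc n) 0 (≡.trans (ℕ.+-identityʳ _) (≡.trans (ℕ.*-identityˡ _) e))))

    θ²-∣ : ∀ {c} → c ∣[q^N] θ * θ
    θ²-∣ = ∣-≈ {g = θ * θ₁} (*-congˡ {θ} {θ} {θ₁} (sum-cong {λ k → q ^ (k ℕ.* k)} {λ k → q ^ (1 ℕ.* (k ℕ.* k))} N
        (λ k → ^-congʳ q (≡.sym (ℕ.*-identityˡ (suc k ℕ.* suc k))))))
      (∣-zero (≡.trans (squares-coefficient 1) (≡.cong (λ l → + length l) (no-representations 1 not-two-squares))))
      where
      θ₁ : Series
      θ₁ = sum N (λ k → q ^ (1 ℕ.* (k ℕ.* k)))

    θv-∣ : 2 ∣[q^N] θ * v
    θv-∣ = coefficient (≡.subst (+ 2 ∣ℤ_) (≡.sym (squares-coefficient 2)) (ℤ∣.∣ᵤ⇒∣ even-representations))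

    -- x² + 4y² = x² + (2y)² is a sum of two squares.
    θw-∣ : ∀ {c} → c ∣[q^N] θ * w
    θw-∣ = ∣-zero (≡.trans (squares-coefficient 4) (≡.cong (λ l → + length l) (no-representations 4
      (λ i j e → not-two-squares i (2 ℕ.* j) (≡.trans (≡.cong (1 ℕ.* (i ℕ.* i) ℕ.+_) (4j² j)) e)))))
      where
      4j² : ∀ j → 1 ℕ.* (2 ℕ.* j ℕ.* (2 ℕ.* j)) ≡ 4 ℕ.* (j ℕ.* j)
      4j² j = ≡.trans (ℕ.*-identityˡ _) (ℕ.[m*n]*[o*p]≡[m*o]*[n*p] 2 j 2 j)

    θ[v+w]-∣ : 2 ∣[q^N] θ * (v + w)
    θ[v+w]-∣ = ∣-≈ {g = θ * v + θ * w} (distribˡ θ v w) (∣-+ θv-∣ θw-∣)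

    -- The parity of r(N) enters here: `θ * v` has the coefficient 2 in the expansion, and its
    -- evenness at q^N supplies the missing factor 2.
    Eκ-∣ : 4 ∣[q^N] E * κ
    Eκ-∣ = ∣-mod Eκ-mod-4
      (∣-+ (∣-+ (∣-+ θ-∣ θ²-∣) (∣-scale 2 θv-∣))
        (even⇒∣ (even-- (even-⊛ (even-# 2) (even-⊛ v-even v-even))
          (even-⊕ (even-⊕ u-even (even-⊛ (even-# 3) (even-⊛ u-even u-even)))
                  (even-⊛ (even-# 2) (even-⊛ (even-⊛ u-even u-even) u-even))))))

    Eκ²-∣ : 2 ∣[q^N] E * (κ * κ)
    Eκ²-∣ = ∣-mod Eκ²-mod-2 (even⇒∣ (even-⊕ v-even (even-⊛ e e)))
      where
      e : Even (v - u - u * u)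
      e = even-- (even-- v-even u-even) (even-⊛ u-even u-even)

    ā-2^m*α : ∀ m α → 2 ℕ.^ (m ℕ.+ 4) ∣ ā (2 ℕ.^ suc m ℕ.* α) N
    ā-2^m*α m α = ā-divisible (2 ℕ.^ (m ℕ.+ 4)) (2 ℕ.^ suc m ℕ.* α)
      (∣-≈ {g = E + # 4 * (# (2 ℕ.^ m) * (E * Z))} expansion (∣-+ (even⇒∣ E-even)
        (≡.subst (_∣[q^N] # 4 * (# (2 ℕ.^ m) * (E * Z))) (modulus m) (∣-scale 4 (∣-scale (2 ℕ.^ m) EZ-∣)))))
      where
      c : ℕ
      c = proj₁ (O^[2^[1+m]α]*E α m)

      Z : Series
      Z = proj₁ (proj₂ (O^[2^[1+m]α]*E α m))

      expansion : O ^ (2 ℕ.^ suc m ℕ.* α) * E ≈ E + # 4 * (# (2 ℕ.^ m) * (E * Z))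
      expansion = proj₁ (proj₂ (proj₂ (O^[2^[1+m]α]*E α m)))

      modulus : ∀ m → 4 ℕ.* (2 ℕ.^ m ℕ.* 4) ≡ 2 ℕ.^ (m ℕ.+ 4)
      modulus m = ≡.trans (ℕ.*-comm 4 (2 ℕ.^ m ℕ.* 4)) (≡.trans (ℕ.*-assoc (2 ℕ.^ m) 4 4) (≡.sym (ℕ.^-distribˡ-+-* 2 m 4)))

      EZ-∣ : 4 ∣[q^N] E * Z
      EZ-∣ = ∣-mod (proj₂ (proj₂ (proj₂ (O^[2^[1+m]α]*E α m)))) (∣-+ (∣-#* α Eκ-∣) (∣-scale 2 (∣-#* c Eκ²-∣)))

    ā-odd : ∀ β → 16 ∣ ā (2 ℕ.* β ℕ.+ 1) N
    ā-odd β = ā-divisible 16 (2 ℕ.* β ℕ.+ 1)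
      (∣-mod (O^[2β+1]*E β) (∣-+ φE²-∣ (∣-scale 4 (∣-#* β κφE²-∣))))
      where
      φE²-∣ : 16 ∣[q^N] φ * (E * E)
      φE²-∣ = ∣-mod φE²-mod-16 (∣--
        (∣-+ (even⇒∣ (even-- (even-# 1) (even-⊛ (even-# 4) (even-⊕ u-even (even-⊛ u-even u-even))))) (∣-#* 2 θ-∣))
        (∣-scale 8 θ[v+w]-∣))

      κφE²-∣ : 4 ∣[q^N] κ * (φ * (E * E))
      κφE²-∣ = ∣-mod κφE²-mod-4 (∣--
        (∣-+ (∣-- (∣-+ θ-∣ (∣-#* 3 θ²-∣)) (even⇒∣ (even-⊕ u-even (even-⊛ u-even u-even)))) (∣-scale 2 θv-∣))
        (∣-scale 2 θ[v+w]-∣))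

-- Counting by bijections and involutions

record Enumeration {I : Set} (P : I → Set) : Set where
  field
    elements : List I
    unique   : Unique.Unique elements
    sound    : ∀ {a} → a ∈ elements → P a
    complete : ∀ {a} → P a → a ∈ elements

  card : ℕ
  card = length elements

open Enumeration

private variable
  I J : Set
  P Q : I → Set

enumerate-filter : (L : List I) → Unique.Unique L → (∀ {a} → P a → a ∈ L) → Decidable P → Enumeration P
enumerate-filter L u c P? = record
  { elements = filter P? L
  ; unique   = Unique.filter⁺ P? u
  ; sound    = λ h → proj₂ (∈-filter⁻ P? {xs = L} h)
  ; complete = λ p → ∈-filter⁺ P? (c p) p
  }

restrict : Enumeration P → Decidable Q → Enumeration (λ a → P a × Q a)
restrict e Q? = record
  { elements = filter Q? (elements e)
  ; unique   = Unique.filter⁺ Q? (unique e)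
  ; sound    = λ h → let a∈ , q = ∈-filter⁻ Q? {xs = elements e} h in sound e a∈ , q
  ; complete = λ (p , q) → ∈-filter⁺ Q? (complete e p) q
  }

-- The image list has no duplicates because `g` undoes `f` on `P`. Two duplicate-free lists with the
-- same members are permutations of each other.
card-bijection : {P : I → Set} {Q : J → Set} (e : Enumeration P) (e′ : Enumeration Q) (f : I → J) (g : J → I) →
  (∀ a → P a → Q (f a) × g (f a) ≡ a) → (∀ b → Q b → P (g b) × f (g b) ≡ b) → card e ≡ card e′
card-bijection e e′ f g to from = ≡.trans (≡.sym (length-map f (elements e)))
  (↭-length (∼bag⇒↭ (unique∧set⇒bag image-unique (unique e′) (mk⇔ image⊆ ⊆image))))
  where
  image-unique : Unique.Unique (map f (elements e))
  image-unique = Unique.map⁻ {f = g} (≡.subst Unique.Unique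
    (≡.sym (≡.trans (≡.sym (map-∘ (elements e))) (map-id-local (All.tabulate (λ a∈ → proj₂ (to _ (sound e a∈))))))) (unique e))

  image⊆ : ∀ {b} → b ∈ map f (elements e) → b ∈ elements e′
  image⊆ h with ∈-map⁻ f h
  ... | a , a∈ , ≡.refl = complete e′ (proj₁ (to a (sound e a∈)))

  ⊆image : ∀ {b} → b ∈ elements e′ → b ∈ map f (elements e)
  ⊆image {b} h = let p , fg = from b (sound e′ h) in ≡.subst (_∈ map f (elements e)) fg (∈-map⁺ f (complete e p))

card-empty : (e : Enumeration P) → (∀ a → ¬ P a) → card e ≡ 0
card-empty e h with elements e | sound e
... | []    | _ = ≡.refl
... | x ∷ _ | s = ⊥-elim (h x (s (here ≡.refl)))

card-split : (e : Enumeration P) (Q? : Decidable Q) → card e ≡ card (restrict e Q?) ℕ.+ card (restrict e (¬? ∘ Q?))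
card-split {Q = Q} e Q? = go (elements e)
  where
  go : ∀ L → length L ≡ length (filter Q? L) ℕ.+ length (filter (¬? ∘ Q?) L)
  go []       = ≡.refl
  go (x ∷ xs) with Q? x
  ... | yes _ = ≡.cong suc (go xs)
  ... | no  _ = ≡.trans (≡.cong suc (go xs)) (≡.sym (ℕ.+-suc (length (filter Q? xs)) _))

positive-neg : ∀ {i} → ℤ.0ℤ ℤ.< i → ¬ ℤ.0ℤ ℤ.< ℤ.- i
positive-neg 0<i 0<-i = ℤ.<-asym 0<i (≡.subst (ℤ._< ℤ.0ℤ) (ℤ.neg-involutive _) (ℤ.neg-mono-< 0<-i))

nonpositive⇒neg-positive : ∀ {i} → i ≢ ℤ.0ℤ → ¬ ℤ.0ℤ ℤ.< i → ℤ.0ℤ ℤ.< ℤ.- i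
nonpositive⇒neg-positive {i} i≢0 ¬0<i with ℤ.<-cmp ℤ.0ℤ i
... | tri< 0<i _ _ = ⊥-elim (¬0<i 0<i)
... | tri≈ _ 0≡i _ = ⊥-elim (i≢0 (≡.sym 0≡i))
... | tri> _ _ i<0 = ℤ.neg-mono-< i<0

-- δ separates a from f a, so the elements with δ ≠ 0 fall into the two halves δ > 0 and δ < 0, exchanged by f.
card-involution : {P : I → Set} (e : Enumeration P) (f : I → I) (δ : I → ℤ) →
  (∀ a → P a → P (f a) × f (f a) ≡ a) → (∀ a → δ (f a) ≡ ℤ.- δ a) →
  card e ≡ card (restrict e (λ a → δ a ℤ.≟ ℤ.0ℤ)) ℕ.+ 2 ℕ.* card (restrict e (λ a → ℤ.0ℤ ℤ.<? δ a))
card-involution {P = P} e f δ inv anti = begin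
  card e
    ≡⟨ card-split e zero? ⟩
  card (restrict e zero?) ℕ.+ card nonzero
    ≡⟨ ≡.cong (card (restrict e zero?) ℕ.+_) (card-split nonzero pos?) ⟩
  card (restrict e zero?) ℕ.+ (card (restrict nonzero pos?) ℕ.+ card (restrict nonzero (¬? ∘ pos?)))
    ≡⟨ ≡.cong (card (restrict e zero?) ℕ.+_) (≡.cong₂ ℕ._+_ positives negatives) ⟩
  card (restrict e zero?) ℕ.+ (card (restrict e pos?) ℕ.+ card (restrict e pos?))
    ≡⟨ ≡.cong (λ m → card (restrict e zero?) ℕ.+ (card (restrict e pos?) ℕ.+ m)) (ℕ.+-identityʳ _) ⟨
  card (restrict e zero?) ℕ.+ 2 ℕ.* card (restrict e pos?) ∎
  where
  open ≡.≡-Reasoning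

  zero? : Decidable (λ a → δ a ≡ ℤ.0ℤ)
  zero? a = δ a ℤ.≟ ℤ.0ℤ

  pos? : Decidable (λ a → ℤ.0ℤ ℤ.< δ a)
  pos? a = ℤ.0ℤ ℤ.<? δ a

  nonzero : Enumeration (λ a → P a × δ a ≢ ℤ.0ℤ)
  nonzero = restrict e (¬? ∘ zero?)

  positives : card (restrict nonzero pos?) ≡ card (restrict e pos?)
  positives = card-bijection (restrict nonzero pos?) (restrict e pos?) (λ a → a) (λ a → a)
    (λ _ ((p , _) , 0<δ) → (p , 0<δ) , ≡.refl)
    (λ _ (p , 0<δ) → ((p , λ δ≡0 → ℤ.<-irrefl (≡.sym δ≡0) 0<δ) , 0<δ) , ≡.refl)

  negatives : card (restrict nonzero (¬? ∘ pos?)) ≡ card (restrict e pos?)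
  negatives = card-bijection (restrict nonzero (¬? ∘ pos?)) (restrict e pos?) f f
    (λ a ((p , δ≢0) , ¬0<δ) → (proj₁ (inv a p) , ≡.subst (ℤ.0ℤ ℤ.<_) (≡.sym (anti a)) (nonpositive⇒neg-positive δ≢0 ¬0<δ)) , proj₂ (inv a p))
    (λ a (p , 0<δ) → ((proj₁ (inv a p)
        , λ e → ℤ.<-irrefl (≡.sym (ℤ.neg-injective {δ a} {ℤ.0ℤ} (≡.trans (≡.sym (anti a)) e))) 0<δ)
        , λ 0<δ′ → positive-neg 0<δ (≡.subst (ℤ.0ℤ ℤ.<_) (anti a) 0<δ′)) , proj₂ (inv a p))

card-free-involution : {P : I → Set} (e : Enumeration P) (f : I → I) (δ : I → ℤ) →
  (∀ a → P a → P (f a) × f (f a) ≡ a) → (∀ a → δ (f a) ≡ ℤ.- δ a) → (∀ a → P a → δ a ≢ ℤ.0ℤ) →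
  card e ≡ 2 ℕ.* card (restrict e (λ a → ℤ.0ℤ ℤ.<? δ a))
card-free-involution e f δ inv anti δ≢0 = ≡.trans (card-involution e f δ inv anti)
  (≡.cong (ℕ._+ 2 ℕ.* card (restrict e (λ a → ℤ.0ℤ ℤ.<? δ a)))
    (card-empty (restrict e (λ a → δ a ℤ.≟ ℤ.0ℤ)) (λ a (p , δ≡0) → δ≢0 a p δ≡0)))

open ≡ using (refl; sym; trans; cong; cong₂; subst)

-- Residues of quadratic forms, and the parity of the number of divisors

module Residues (m : ℕ) .{{_ : NonZero m}} where

  *-mod : ∀ {x x′ y y′} → x % m ≡ x′ % m → y % m ≡ y′ % m → (x ℕ.* y) % m ≡ (x′ ℕ.* y′) % m
  *-mod {x} {x′} {y} {y′} p q = trans (%-distribˡ-* x y m) (trans (cong₂ (λ a b → (a ℕ.* b) % m) p q) (sym (%-distribˡ-* x′ y′ m)))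

  +-mod : ∀ {x x′ y y′} → x % m ≡ x′ % m → y % m ≡ y′ % m → (x ℕ.+ y) % m ≡ (x′ ℕ.+ y′) % m
  +-mod {x} {x′} {y} {y′} p q = trans (%-distribˡ-+ x y m) (trans (cong₂ (λ a b → (a ℕ.+ b) % m) p q) (sym (%-distribˡ-+ x′ y′ m)))

  squareForm-% : ∀ a b i j → squareForm a b (i , j) % m ≡ squareForm a b (i % m , j % m) % m
  squareForm-% a b i j = +-mod {a ℕ.* (i ℕ.* i)} {_} {b ℕ.* (j ℕ.* j)} (term a i) (term b j)
    where
    term : ∀ a i → (a ℕ.* (i ℕ.* i)) % m ≡ (a ℕ.* (i % m ℕ.* (i % m))) % m
    term a i = *-mod {a} {a} {i ℕ.* i} refl (*-mod {i} {i % m} {i} (sym (m%n%n≡m%n i m)) (sym (m%n%n≡m%n i m)))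

  -- Reduces the claim to finitely many residues, where it is decided by evaluation.
  squareForm-avoids : ∀ a b r → (∀ (i j : Fin m) → squareForm a b (toℕ i , toℕ j) % m ≢ r) →
                      ∀ i j → squareForm a b (i , j) % m ≢ r
  squareForm-avoids a b r h i j e = h (fromℕ< (m%n<n i m)) (fromℕ< (m%n<n j m))
    (trans (cong₂ (λ i j → squareForm a b (i , j) % m) (toℕ-fromℕ< (m%n<n i m)) (toℕ-fromℕ< (m%n<n j m)))
           (trans (sym (squareForm-% a b i j)) e))

x²+y²%4≢3 : ∀ i j → squareForm 1 1 (i , j) % 4 ≢ 3
x²+y²%4≢3 = Residues.squareForm-avoids 4 1 1 3 (from-yes (all? {4} λ i → all? {4} λ j → ¬? (squareForm 1 1 (toℕ i , toℕ j) % 4 ℕ.≟ 3)))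

x²+2y²%8≢7 : ∀ i j → squareForm 1 2 (i , j) % 8 ≢ 7
x²+2y²%8≢7 = Residues.squareForm-avoids 8 1 2 7 (from-yes (all? {8} λ i → all? {8} λ j → ¬? (squareForm 1 2 (toℕ i , toℕ j) % 8 ℕ.≟ 7)))

-- Over ℕ, x² + 6y² stands in for x² - 2y², to which it is congruent modulo 8.
x²+6y²%8≢3 : ∀ i j → squareForm 1 6 (i , j) % 8 ≢ 3
x²+6y²%8≢3 = Residues.squareForm-avoids 8 1 6 3 (from-yes (all? {8} λ i → all? {8} λ j → ¬? (squareForm 1 6 (toℕ i , toℕ j) % 8 ℕ.≟ 3)))

FactorPair : ℕ → ℕ × ℕ → Set
FactorPair n (a , b) = a ℕ.* b ≡ n

factorPairs : ∀ n .{{_ : NonZero n}} → Enumeration (FactorPair n)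
factorPairs n = enumerate-filter (cartesianProduct (upTo (suc n)) (upTo (suc n)))
  (Unique.cartesianProduct⁺ (Unique.upTo⁺ (suc n)) (Unique.upTo⁺ (suc n)))
  (λ {ab} h → ∈-cartesianProduct⁺ (∈-upTo⁺ (s≤s (bounded (proj₁ ab) (proj₂ ab) h)))
     (∈-upTo⁺ (s≤s (bounded (proj₂ ab) (proj₁ ab) (trans (ℕ.*-comm (proj₂ ab) (proj₁ ab)) h)))))
  (λ (a , b) → a ℕ.* b ℕ.≟ n)
  where
  bounded : ∀ a b → a ℕ.* b ≡ n → a ≤ n
  bounded a zero    h = ⊥-elim (ℕ.≢-nonZero⁻¹ n (trans (sym h) (ℕ.*-zeroʳ a)))
  bounded a (suc b) h = ℕ.≤-trans (ℕ.m≤m*n a (suc b)) (ℕ.≤-reflexive h)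

difference : ℕ × ℕ → ℤ
difference (a , b) = + b ℤ.- + a

increasingPairs : ∀ n .{{_ : NonZero n}} → Enumeration (λ ab → FactorPair n ab × 0ℤ ℤ.< difference ab)
increasingPairs n = restrict (factorPairs n) (λ ab → 0ℤ ℤ.<? difference ab)

-- Swapping the factors is an involution whose fixed points would be square roots of n. The left
-- side is the divisor function d(n).
card-factorPairs : ∀ n .{{_ : NonZero n}} → (∀ a → a ℕ.* a ≢ n) → card (factorPairs n) ≡ 2 ℕ.* card (increasingPairs n)
card-factorPairs n nonsquare = card-free-involution (factorPairs n) (λ (a , b) → b , a) difference
  (λ (a , b) h → trans (ℕ.*-comm b a) h , refl)
  (λ (a , b) → +-*-Solver.solve 2 (λ a b → a +-*-Solver.:- b +-*-Solver.:= +-*-Solver.:- (b +-*-Solver.:- a)) refl (+ a) (+ b))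
  (λ (a , b) h δ≡0 → nonsquare a (trans (cong (a ℕ.*_) (sym (ℤ.+-injective (ℤ.i-j≡0⇒i≡j (+ b) (+ a) δ≡0)))) h))

module PrimePower (p M : ℕ) (prime : Prime p) .{{_ : NonZero M}} (p∤M : p ∤ M) where

  instance
    p-nonZero : NonZero p
    p-nonZero = prime⇒nonZero prime

  level : ℕ → ℕ
  level e = p ℕ.^ e ℕ.* M

  level-nonZero : ∀ e → NonZero (level e)
  level-nonZero e = ℕ.m*n≢0 (p ℕ.^ e) M {{ℕ.m^n≢0 p e}}

  pairs : ∀ e → Enumeration (FactorPair (level e))
  pairs e = factorPairs (level e) {{level-nonZero e}}

  p∣? : Decidable (λ (ab : ℕ × ℕ) → p ∣ proj₁ ab)
  p∣? ab = p ∣? proj₁ ab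

  level-suc : ∀ e → level (suc e) ≡ p ℕ.* level e
  level-suc e = ℕ.*-assoc p (p ℕ.^ e) M

  divisible-part : ∀ e → card (restrict (pairs (suc e)) p∣?) ≡ card (pairs e)
  divisible-part e = card-bijection (restrict (pairs (suc e)) p∣?) (pairs e)
    (λ (a , b) → a / p , b) (λ (a , b) → p ℕ.* a , b)
    (λ { (_ , b) (h , divides a refl) →
         let a*p/p≡a = m*n/n≡m a p in
         ℕ.*-cancelˡ-≡ _ _ p (trans (trans (cong (λ x → p ℕ.* (x ℕ.* b)) a*p/p≡a) (trans (sym (ℕ.*-assoc p a b)) (cong (ℕ._* b) (ℕ.*-comm p a)))) (trans h (level-suc e)))
       , cong (_, b) (trans (cong (p ℕ.*_) a*p/p≡a) (ℕ.*-comm p a)) })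
    (λ { (a , b) h → (trans (ℕ.*-assoc p a b) (trans (cong (p ℕ.*_) h) (sym (level-suc e))) , m∣m*n a)
                   , cong (_, b) (m*n/m≡n p a) })
    where
    m*n/m≡n : ∀ m n .{{_ : NonZero m}} → m ℕ.* n / m ≡ n
    m*n/m≡n m n = trans (cong (_/ m) (ℕ.*-comm m n)) (m*n/n≡m n m)

  -- If p does not divide a, Euclid's lemma puts a factor p into b, where it can be removed.
  coprime-part : ∀ e → card (restrict (pairs (suc e)) (¬? ∘ p∣?)) ≡ card (restrict (pairs e) (¬? ∘ p∣?))
  coprime-part e = card-bijection (restrict (pairs (suc e)) (¬? ∘ p∣?)) (restrict (pairs e) (¬? ∘ p∣?))
    (λ (a , b) → a , b / p) (λ (a , b) → a , b ℕ.* p) to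
    (λ { (a , b) (h , p∤a) → (trans (sym (ℕ.*-assoc a b p)) (trans (cong (ℕ._* p) h) (trans (ℕ.*-comm (level e) p) (sym (level-suc e)))) , p∤a)
                           , cong (a ,_) (m*n/n≡m b p) })
    where
    to : ∀ ab → FactorPair (level (suc e)) ab × p ∤ proj₁ ab →
         (FactorPair (level e) (proj₁ ab , proj₂ ab / p) × p ∤ proj₁ ab) × (proj₁ ab , proj₂ ab / p ℕ.* p) ≡ ab
    to (a , b) (h , p∤a) with euclidsLemma a b prime (subst (p ∣_) (sym (trans h (level-suc e))) (m∣m*n (level e)))
    ... | inj₁ p∣a = ⊥-elim (p∤a p∣a)
    ... | inj₂ p∣b = (ℕ.*-cancelʳ-≡ _ _ p (trans (ℕ.*-assoc a (b / p) p)
                       (trans (cong (a ℕ.*_) (m/n*n≡m p∣b)) (trans h (trans (level-suc e) (ℕ.*-comm p (level e)))))) , p∤a)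
                   , cong (a ,_) (m/n*n≡m p∣b)

  coprime-card : ∀ e → card (restrict (pairs e) (¬? ∘ p∣?)) ≡ card (pairs 0)
  coprime-card (suc e) = trans (coprime-part e) (coprime-card e)
  coprime-card zero    = card-bijection (restrict (pairs 0) (¬? ∘ p∣?)) (pairs 0) (λ a → a) (λ a → a)
    (λ _ (h , _) → h , refl)
    (λ (a , b) h → (h , λ p∣a → p∤M (subst (p ∣_) (trans h (ℕ.*-identityˡ M)) (∣m⇒∣m*n b p∣a))) , refl)

  -- Pairs with p ∣ a correspond to all pairs one level down. Pairs with p ∤ a can be lowered to
  -- level 0, where p ∤ M makes the condition automatic.
  card-pairs : ∀ e → card (pairs e) ≡ suc e ℕ.* card (pairs 0)
  card-pairs zero    = sym (ℕ.*-identityˡ _)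
  card-pairs (suc e) = begin
    card (pairs (suc e))                                                             ≡⟨ card-split (pairs (suc e)) p∣? ⟩
    card (restrict (pairs (suc e)) p∣?) ℕ.+ card (restrict (pairs (suc e)) (¬? ∘ p∣?)) ≡⟨ cong₂ ℕ._+_ (divisible-part e) (coprime-card (suc e)) ⟩
    card (pairs e) ℕ.+ card (pairs 0)                                                ≡⟨ cong (ℕ._+ card (pairs 0)) (card-pairs e) ⟩
    suc e ℕ.* card (pairs 0) ℕ.+ card (pairs 0)                                      ≡⟨ ℕ.+-comm _ (card (pairs 0)) ⟩
    suc (suc e) ℕ.* card (pairs 0)                                                   ∎
    where open ≡.≡-Reasoning

  increasing : ∀ e → Enumeration (λ ab → FactorPair (level e) ab × 0ℤ ℤ.< difference ab)
  increasing e = increasingPairs (level e) {{level-nonZero e}}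

  -- Of the two factors 2, one from the odd exponent of p and one from M not being a square, only
  -- one is lost in passing from all pairs to increasing ones.
  even-increasingPairs : ∀ k → (∀ a → a ℕ.* a ≢ level 0) → (∀ a → a ℕ.* a ≢ level (2 ℕ.* k ℕ.+ 1)) →
    2 ∣ card (increasing (2 ℕ.* k ℕ.+ 1))
  even-increasingPairs k ns₀ ns = subst (2 ∣_) (ℕ.*-cancelˡ-≡ _ _ 2 (sym (begin
    2 ℕ.* card (increasing (2 ℕ.* k ℕ.+ 1)) ≡⟨ card-factorPairs (level (2 ℕ.* k ℕ.+ 1)) {{level-nonZero (2 ℕ.* k ℕ.+ 1)}} ns ⟨
    card (pairs (2 ℕ.* k ℕ.+ 1))                         ≡⟨ card-pairs (2 ℕ.* k ℕ.+ 1) ⟩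
    suc (2 ℕ.* k ℕ.+ 1) ℕ.* card (pairs 0)               ≡⟨ cong (suc (2 ℕ.* k ℕ.+ 1) ℕ.*_) (card-factorPairs (level 0) {{level-nonZero 0}} ns₀) ⟩
    suc (2 ℕ.* k ℕ.+ 1) ℕ.* (2 ℕ.* h)
      ≡⟨ ℕ-Solver.solve 2 (λ k h → (ℕ-Solver.con 1 ℕ-Solver.:+ (ℕ-Solver.con 2 ℕ-Solver.:* k ℕ-Solver.:+ ℕ-Solver.con 1)) ℕ-Solver.:* (ℕ-Solver.con 2 ℕ-Solver.:* h)
           ℕ-Solver.:= ℕ-Solver.con 2 ℕ-Solver.:* (ℕ-Solver.con 2 ℕ-Solver.:* ((k ℕ-Solver.:+ ℕ-Solver.con 1) ℕ-Solver.:* h))) refl k h ⟩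
    2 ℕ.* (2 ℕ.* ((k ℕ.+ 1) ℕ.* h)) ∎))) (m∣m*n ((k ℕ.+ 1) ℕ.* h))
    where
    open ≡.≡-Reasoning
    h : ℕ
    h = card (increasing 0)

-- Representations by x² + 2y²

module TernaryForm (N : ℕ) where
  open import Data.Integer using (_+_; _*_; -_; _-_)
  open +-*-Solver using (solve; _:+_; _:*_; _:-_; :-_; con; _:=_; Polynomial)

  Positive : ℤ → Set
  Positive i = 0ℤ ℤ.< i

  positive? : Decidable Positive
  positive? i = 0ℤ ℤ.<? i

  Triple : Set
  Triple = ℤ × ℤ × ℤ

  triple-≡ : ∀ {x y z x′ y′ z′ : ℤ} → x ≡ x′ → y ≡ y′ → z ≡ z′ → _≡_ {A = Triple} (x , y , z) (x′ , y′ , z′)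
  triple-≡ refl refl refl = refl

  record Solution (t : Triple) : Set where
    constructor solution
    field
      equation   : proj₁ t * proj₁ t + + 2 * (proj₁ (proj₂ t) * proj₂ (proj₂ t)) ≡ + N
      y-positive : Positive (proj₁ (proj₂ t))
      z-positive : Positive (proj₂ (proj₂ t))

  solution? : Decidable Solution
  solution? (x , y , z) = map′ (λ (e , py , pz) → solution e py pz) (λ (solution e py pz) → e , py , pz)
    (x * x + + 2 * (y * z) ℤ.≟ + N ×-dec positive? y ×-dec positive? z)

  square-abs : ∀ x → x * x ≡ + (∣ x ∣ ℕ.* ∣ x ∣)
  square-abs (+ n)      = sym (ℤ.pos-* n n)
  square-abs (-[1+ n ]) = refl

  quadratic-abs : ∀ b x y → x * x + + b * (y * y) ≡ + squareForm 1 b (∣ x ∣ , ∣ y ∣)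
  quadratic-abs b x y = cong₂ _+_ (trans (square-abs x) (cong +_ (sym (ℕ.*-identityˡ (∣ x ∣ ℕ.* ∣ x ∣)))))
    (trans (cong (+ b *_) (square-abs y)) (sym (ℤ.pos-* b (∣ y ∣ ℕ.* ∣ y ∣))))

  box : List ℤ
  box = map +_ (upTo (suc N)) ++ map -[1+_] (upTo N)

  ∈-box : ∀ i → ∣ i ∣ ≤ N → i ∈ box
  ∈-box (+ n)    h = ∈-++⁺ˡ (∈-map⁺ +_ (∈-upTo⁺ (s≤s h)))
  ∈-box -[1+ n ] h = ∈-++⁺ʳ (map +_ (upTo (suc N))) (∈-map⁺ -[1+_] (∈-upTo⁺ h))

  box-unique : Unique.Unique box
  box-unique = Unique.++⁺ (Unique.map⁺ (λ { refl → refl }) (Unique.upTo⁺ (suc N))) (Unique.map⁺ (λ { refl → refl }) (Unique.upTo⁺ N))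
    (λ (a , b) → disjoint (∈-map⁻ +_ a) (∈-map⁻ -[1+_] b))
    where
    disjoint : ∀ {v} → (∃ λ m → m ∈ upTo (suc N) × v ≡ + m) → (∃ λ n → n ∈ upTo N × v ≡ -[1+ n ]) → ⊥
    disjoint (_ , _ , refl) (_ , _ , ())

  m≤m*m : ∀ m → m ≤ m ℕ.* m
  m≤m*m zero    = z≤n
  m≤m*m (suc m) = ℕ.m≤m*n (suc m) (suc m)

  solution-bounds : ∀ x y z → Solution (x , y , z) → ∣ x ∣ ≤ N × ∣ y ∣ ≤ N × ∣ z ∣ ≤ N
  solution-bounds x (+ suc b) (+ suc c) (solution e _ _) =
      ℕ.≤-trans (m≤m*m ∣ x ∣) (ℕ.≤-trans (ℕ.m≤m+n _ _) (ℕ.≤-reflexive eℕ))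
    , ℕ.≤-trans (ℕ.m≤m*n (suc b) (suc c)) yz≤N
    , ℕ.≤-trans (ℕ.m≤n*m (suc c) (suc b)) yz≤N
    where
    eℕ : ∣ x ∣ ℕ.* ∣ x ∣ ℕ.+ 2 ℕ.* (suc b ℕ.* suc c) ≡ N
    eℕ = ℤ.+-injective (trans (cong₂ _+_ (sym (square-abs x)) (trans (ℤ.pos-* 2 (suc b ℕ.* suc c)) (cong (+ 2 *_) (ℤ.pos-* (suc b) (suc c))))) e)

    yz≤N : suc b ℕ.* suc c ≤ N
    yz≤N = ℕ.≤-trans (ℕ.m≤n*m (suc b ℕ.* suc c) 2) (ℕ.≤-trans (ℕ.m≤n+m _ (∣ x ∣ ℕ.* ∣ x ∣)) (ℕ.≤-reflexive eℕ))
  solution-bounds x (+ zero)  _          (solution _ (ℤ.+<+ ()) _)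
  solution-bounds x -[1+ _ ]  _          (solution _ () _)
  solution-bounds x (+ suc b) (+ zero)   (solution _ _ (ℤ.+<+ ()))
  solution-bounds x (+ suc b) -[1+ _ ]   (solution _ _ ())

  solutions : Enumeration Solution
  solutions = enumerate-filter (cartesianProduct box (cartesianProduct box box))
    (Unique.cartesianProduct⁺ box-unique (Unique.cartesianProduct⁺ box-unique box-unique))
    (λ {(x , y , z)} h → let bx , by , bz = solution-bounds x y z h in
       ∈-cartesianProduct⁺ (∈-box x bx) (∈-cartesianProduct⁺ (∈-box y by) (∈-box z bz)))
    solution?

  -- The solutions split into U > 0, its image - B > 0 under (x , y , z) ↦ (- x , z , y), and the region A > 0, B > 0,
  -- on which x² + 2yz = W² + 2AB provides further symmetries.
  X U A B W : Triple → ℤ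
  X (x , y , z) = x
  U (x , y , z) = + 2 * x - + 2 * y + z
  A (x , y , z) = + 2 * y - + 2 * x - z
  B (x , y , z) = + 2 * x + + 2 * z - y
  W (x , y , z) = + 3 * x - + 2 * y + + 2 * z

  :U :A :B :W : ∀ {m} → Polynomial m → Polynomial m → Polynomial m → Polynomial m
  :U x y z = con (+ 2) :* x :- con (+ 2) :* y :+ z
  :A x y z = con (+ 2) :* y :- con (+ 2) :* x :- z
  :B x y z = con (+ 2) :* x :+ con (+ 2) :* z :- y
  :W x y z = con (+ 3) :* x :- con (+ 2) :* y :+ con (+ 2) :* z

  transfer : ∀ {i j} → i ≡ j → Positive i → Positive j
  transfer = subst Positive

  module _ (N%8≡3 : N % 8 ≡ 3) where

    N%4≡3 : N % 4 ≡ 3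
    N%4≡3 = trans (sym (m∣n⇒o%n%m≡o%m 4 8 N (divides 2 refl))) (cong (_% 4) N%8≡3)

    N%2≡1 : N % 2 ≡ 1
    N%2≡1 = trans (sym (m∣n⇒o%n%m≡o%m 2 8 N (divides 4 refl))) (cong (_% 2) N%8≡3)

    2∤N : 2 ∤ N
    2∤N 2∣N with trans (sym (n∣m⇒m%n≡0 N 2 2∣N)) N%2≡1
    ... | ()

    not-two-squares : ∀ {x y} → x * x + y * y ≢ + N
    not-two-squares {x} {y} e = x²+y²%4≢3 ∣ x ∣ ∣ y ∣ (trans (cong (_% 4) (ℤ.+-injective (trans
      (sym (quadratic-abs 1 x y)) (trans (cong (λ t → x * x + t) (ℤ.*-identityˡ (y * y))) e)))) N%4≡3)

    not-x²-2y² : ∀ {x y} → x * x - + 2 * (y * y) ≢ + N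
    not-x²-2y² {x} {y} e = x²+6y²%8≢3 ∣ x ∣ ∣ y ∣ (trans (cong (_% 8) (ℤ.+-injective (begin
      + squareForm 1 6 (∣ x ∣ , ∣ y ∣)                 ≡⟨ quadratic-abs 6 x y ⟨
      x * x + + 6 * (y * y)                            ≡⟨ solve 2 (λ x y → x :* x :+ con (+ 6) :* (y :* y) := x :* x :- con (+ 2) :* (y :* y) :+ y :* y :* con (+ 8)) refl x y ⟩
      x * x - + 2 * (y * y) + y * y * + 8              ≡⟨ cong₂ _+_ e (trans (cong (_* + 8) (square-abs y)) (sym (ℤ.pos-* (∣ y ∣ ℕ.* ∣ y ∣) 8))) ⟩
      + (N ℕ.+ ∣ y ∣ ℕ.* ∣ y ∣ ℕ.* 8)                  ∎)))
      (trans ([m+kn]%n≡m%n N (∣ y ∣ ℕ.* ∣ y ∣) 8) N%8≡3))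
      where open ≡.≡-Reasoning

    not-even : ∀ {x} → + 2 * x ≢ + N
    not-even {x} e = 2∤N (subst (2 ∣_) (trans (sym (ℤ.abs-* (+ 2) x)) (cong ∣_∣ e)) (m∣m*n ∣ x ∣))

    module _ (x y z : ℤ) (solves : Solution (x , y , z)) where
      private
        t : Triple
        t = x , y , z

      X≢0 : X t ≢ 0ℤ
      X≢0 h = not-even {y * z} (trans (trans (solve 3 (λ x y z → con (+ 2) :* (y :* z) := x :* x :+ con (+ 2) :* (y :* z) :- x :* x) refl x y z)
        (cong₂ (λ a b → a - b * x) (Solution.equation solves) h)) (ℤ.+-identityʳ (+ N)))

      private
        -- The form x² + 2yz is written as N′ plus a multiple of a linear form f, so that N = N′ on
        -- the plane f = 0. Each plane used below is ruled out by an N′ that N cannot be: even, a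
        -- square, a sum of two squares, or a² - 2b².
        vanishing : ∀ {f c N′} → x * x + + 2 * (y * z) ≡ N′ + f * c → f ≡ 0ℤ → N′ ≡ + N
        vanishing {N′ = N′} h refl = trans (sym (ℤ.+-identityʳ N′)) (trans (sym h) (Solution.equation solves))

      W≢0 : W t ≢ 0ℤ
      W≢0 = not-even {B t * A t} ∘ vanishing {c = W t} (solve 3 (λ x y z →
        x :* x :+ con (+ 2) :* (y :* z) := con (+ 2) :* ((:B x y z) :* (:A x y z)) :+ (:W x y z) :* (:W x y z)) refl x y z)

      U≢0 : U t ≢ 0ℤ
      U≢0 = not-two-squares {x - + 2 * y} {0ℤ} ∘ vanishing {c = + 2 * y} (solve 3 (λ x y z →
        let s = x :- con (+ 2) :* y in x :* x :+ con (+ 2) :* (y :* z) := s :* s :+ con 0ℤ :* con 0ℤ :+ :U x y z :* (con (+ 2) :* y)) refl x y z)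

      B≢0 : B t ≢ 0ℤ
      B≢0 = not-two-squares {x + + 2 * z} {0ℤ} ∘ vanishing {c = - (+ 2 * z)} (solve 3 (λ x y z →
        let s = x :+ con (+ 2) :* z in x :* x :+ con (+ 2) :* (y :* z) := s :* s :+ con 0ℤ :* con 0ℤ :+ :B x y z :* :- (con (+ 2) :* z)) refl x y z)

      W-X≢0 : W t - X t ≢ 0ℤ
      W-X≢0 = not-two-squares {x + z} {z} ∘ vanishing {c = - z} (solve 3 (λ x y z →
        x :* x :+ con (+ 2) :* (y :* z) := (x :+ z) :* (x :+ z) :+ z :* z :+ (:W x y z :- x) :* :- z) refl x y z)

      -W-X≢0 : - W t - X t ≢ 0ℤ
      -W-X≢0 = not-x²-2y² {x + + 2 * z} {z} ∘ vanishing {c = z} (solve 3 (λ x y z →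
        let s = x :+ con (+ 2) :* z in x :* x :+ con (+ 2) :* (y :* z) := s :* s :- con (+ 2) :* (z :* z) :+ (:- :W x y z :- x) :* z) refl x y z)

    T-set : Enumeration (λ t → Solution t × Positive (X t))
    T-set = restrict solutions (positive? ∘ X)

    U-set : Enumeration (λ t → Solution t × Positive (U t))
    U-set = restrict solutions (positive? ∘ U)

    InV : Triple → Set
    InV t = ((Solution t × Positive (X t)) × Positive (A t)) × Positive (B t)

    V-set : Enumeration InV
    V-set = restrict (restrict T-set (positive? ∘ A)) (positive? ∘ B)

    -- `U-set` is not confined to x > 0. Its part with x < 0 is carried by `ι` onto the piece - B >
    -- 0 of `T-set`, so two of the three pieces of `T-set` reassemble into `U-set`.
    T≡U+V : card T-set ≡ card U-set ℕ.+ card V-set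
    T≡U+V = begin
      card T-set
        ≡⟨ card-split T-set (positive? ∘ U) ⟩
      card (restrict T-set (positive? ∘ U)) ℕ.+ card T∖U
        ≡⟨ cong (card (restrict T-set (positive? ∘ U)) ℕ.+_) (card-split T∖U (positive? ∘ -B)) ⟩
      card (restrict T-set (positive? ∘ U)) ℕ.+ (card (restrict T∖U (positive? ∘ -B)) ℕ.+ card (restrict T∖U (¬? ∘ positive? ∘ -B)))
        ≡⟨ cong₂ ℕ._+_ TU (cong₂ ℕ._+_ TιU TV) ⟩
      card (restrict U-set (positive? ∘ X)) ℕ.+ (card (restrict U-set (¬? ∘ positive? ∘ X)) ℕ.+ card V-set)
        ≡⟨ ℕ.+-assoc (card (restrict U-set (positive? ∘ X))) _ _ ⟨
      card (restrict U-set (positive? ∘ X)) ℕ.+ card (restrict U-set (¬? ∘ positive? ∘ X)) ℕ.+ card V-set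
        ≡⟨ cong (ℕ._+ card V-set) (card-split U-set (positive? ∘ X)) ⟨
      card U-set ℕ.+ card V-set ∎
      where
      open ≡.≡-Reasoning

      -B : Triple → ℤ
      -B t = - B t

      T∖U : Enumeration (λ t → (Solution t × Positive (X t)) × ¬ Positive (U t))
      T∖U = restrict T-set (¬? ∘ positive? ∘ U)

      TU : card (restrict T-set (positive? ∘ U)) ≡ card (restrict U-set (positive? ∘ X))
      TU = card-bijection (restrict T-set (positive? ∘ U)) (restrict U-set (positive? ∘ X)) (λ t → t) (λ t → t)
        (λ _ ((s , px) , pu) → ((s , pu) , px) , refl) (λ _ ((s , pu) , px) → ((s , px) , pu) , refl)

      A≡-U : ∀ x y z → A (x , y , z) ≡ - U (x , y , z)
      A≡-U = solve 3 (λ x y z → :A x y z := :- :U x y z) refl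

      TV : card (restrict T∖U (¬? ∘ positive? ∘ -B)) ≡ card V-set
      TV = card-bijection (restrict T∖U (¬? ∘ positive? ∘ -B)) V-set (λ t → t) (λ t → t)
        (λ (x , y , z) ((s , ¬pu) , ¬p-b) →
            ((s , transfer (sym (A≡-U x y z)) (nonpositive⇒neg-positive (U≢0 x y z (proj₁ s)) ¬pu))
              , transfer (ℤ.neg-involutive (B (x , y , z)))
                  (nonpositive⇒neg-positive (λ h → B≢0 x y z (proj₁ s) (ℤ.neg-injective {B (x , y , z)} {0ℤ} h)) ¬p-b)) , refl)
        (λ (x , y , z) ((s , pa) , pb) → ((s , λ pu → positive-neg pu (transfer (A≡-U x y z) pa)) , positive-neg pb) , refl)

      ι : Triple → Triple
      ι (x , y , z) = - x , z , y

      ι-solution : ∀ t → Solution t → Solution (ι t)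
      ι-solution (x , y , z) (solution e py pz) = solution
        (trans (solve 3 (λ x y z → :- x :* :- x :+ con (+ 2) :* (z :* y) := x :* x :+ con (+ 2) :* (y :* z)) refl x y z) e) pz py

      U-ι : ∀ x y z → U (ι (x , y , z)) ≡ -B (x , y , z)
      U-ι = solve 3 (λ x y z → :U (:- x) z y := :- :B x y z) refl

      -B-ι : ∀ x y z → -B (ι (x , y , z)) ≡ U (x , y , z)
      -B-ι = solve 3 (λ x y z → :- :B (:- x) z y := :U x y z) refl

      ι-ι : ∀ t → ι (ι t) ≡ t
      ι-ι (x , y , z) = triple-≡ (ℤ.neg-involutive x) refl refl

      -- Since y + z > 0, a solution and its image under `ι` cannot both have U > 0, so the pieces U
      -- > 0 and - B > 0 are disjoint.
      U+U∘ι : ∀ x y z → U (x , y , z) + U (ι (x , y , z)) ≡ - (y + z)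
      U+U∘ι = solve 3 (λ x y z → :U x y z :+ :U (:- x) z y := :- (y :+ z)) refl

      TιU : card (restrict T∖U (positive? ∘ -B)) ≡ card (restrict U-set (¬? ∘ positive? ∘ X))
      TιU = card-bijection (restrict T∖U (positive? ∘ -B)) (restrict U-set (¬? ∘ positive? ∘ X)) ι ι
        (λ t@(x , y , z) (((s , px) , _) , p-b) → ((ι-solution t s , transfer (sym (U-ι x y z)) p-b) , positive-neg px) , ι-ι t)
        (λ t@(x , y , z) ((s , pu) , ¬px) →
            (((ι-solution t s , nonpositive⇒neg-positive (X≢0 x y z s) ¬px)
            , λ puι → positive-neg (ℤ.+-mono-< (Solution.y-positive s) (Solution.z-positive s)) (transfer (U+U∘ι x y z) (ℤ.+-mono-< pu puι)))
            , transfer (sym (-B-ι x y z)) pu) , ι-ι t)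

    -- σ and ισ both preserve A > 0, B > 0; σ keeps X > 0 when W > 0, and ισ keeps it when W < 0.
    σ ισ : Triple → Triple
    σ  t = W t , B t , A t
    ισ t = - W t , A t , B t

    module _ (x y z : ℤ) where
      private
        s : Triple
        s = x , y , z

      A-σ : A (σ s) ≡ z
      A-σ = solve 3 (λ x y z → :A (:W x y z) (:B x y z) (:A x y z) := z) refl x y z

      B-σ : B (σ s) ≡ y
      B-σ = solve 3 (λ x y z → :B (:W x y z) (:B x y z) (:A x y z) := y) refl x y z

      W-σ : W (σ s) ≡ x
      W-σ = solve 3 (λ x y z → :W (:W x y z) (:B x y z) (:A x y z) := x) refl x y z

      A-ισ : A (ισ s) ≡ y
      A-ισ = solve 3 (λ x y z → :A (:- :W x y z) (:A x y z) (:B x y z) := y) refl x y z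

      B-ισ : B (ισ s) ≡ z
      B-ισ = solve 3 (λ x y z → :B (:- :W x y z) (:A x y z) (:B x y z) := z) refl x y z

      W-ισ : W (ισ s) ≡ - x
      W-ισ = solve 3 (λ x y z → :W (:- :W x y z) (:A x y z) (:B x y z) := :- x) refl x y z

      -- `σ` is the reflection of the form x² + 2yz in the vector (1 , 1 , -1) of norm -1, hence an
      -- isometry.
      form-σ : W s * W s + + 2 * (B s * A s) ≡ x * x + + 2 * (y * z)
      form-σ = solve 3 (λ x y z →
        :W x y z :* :W x y z :+ con (+ 2) :* (:B x y z :* :A x y z) := x :* x :+ con (+ 2) :* (y :* z)) refl x y z

      form-ισ : - W s * - W s + + 2 * (A s * B s) ≡ x * x + + 2 * (y * z)
      form-ισ = solve 3 (λ x y z →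
        :- :W x y z :* :- :W x y z :+ con (+ 2) :* (:A x y z :* :B x y z) := x :* x :+ con (+ 2) :* (y :* z)) refl x y z

    -- A fixed point of `σ` has W = X and would make N = (x + z)² + z²; one of `ισ` has - W = X and
    -- would make N = (x + 2z)² - 2z². Neither occurs for N ≡ 3 (mod 8).
    V-even : 2 ∣ card V-set
    V-even = subst (2 ∣_) (sym (card-split V-set (positive? ∘ W))) (∣m∣n⇒∣m+n V₊-even V₋-even)
      where
      V₊-even : 2 ∣ card (restrict V-set (positive? ∘ W))
      V₊-even = subst (2 ∣_)
        (sym (card-free-involution V₊ σ (λ t → W t - X t) σ-involution
          (λ (x , y , z) → trans (cong (_- W (x , y , z)) (W-σ x y z)) (swap-difference x (W (x , y , z))))
          (λ (x , y , z) ((((s , _) , _) , _) , _) → W-X≢0 x y z s)))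
        (m∣m*n (card (restrict V₊ (λ t → positive? (W t - X t)))))
        where
        V₊ : Enumeration (λ t → InV t × Positive (W t))
        V₊ = restrict V-set (positive? ∘ W)

        swap-difference : ∀ a b → a - b ≡ - (b - a)
        swap-difference = solve 2 (λ a b → a :- b := :- (b :- a)) refl

        σ-involution : ∀ t → InV t × Positive (W t) → (InV (σ t) × Positive (W (σ t))) × σ (σ t) ≡ t
        σ-involution (x , y , z) ((((solution e py pz , px) , pa) , pb) , pw) =
            ((((solution (trans (form-σ x y z) e) pb pa , pw) , transfer (sym (A-σ x y z)) pz)
              , transfer (sym (B-σ x y z)) py) , transfer (sym (W-σ x y z)) px)
          , triple-≡ (W-σ x y z) (B-σ x y z) (A-σ x y z)

      V₋-even : 2 ∣ card (restrict V-set (¬? ∘ positive? ∘ W))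
      V₋-even = subst (2 ∣_)
        (sym (card-free-involution V₋ ισ (λ t → - W t - X t) ισ-involution
          (λ (x , y , z) → trans (cong (λ w → - w - - W (x , y , z)) (W-ισ x y z)) (swap-sum x (W (x , y , z))))
          (λ (x , y , z) ((((s , _) , _) , _) , _) → -W-X≢0 x y z s)))
        (m∣m*n (card (restrict V₋ (λ t → positive? (- W t - X t)))))
        where
        V₋ : Enumeration (λ t → InV t × ¬ Positive (W t))
        V₋ = restrict V-set (¬? ∘ positive? ∘ W)

        swap-sum : ∀ a b → - (- a) - - b ≡ - (- b - a)
        swap-sum = solve 2 (λ a b → :- (:- a) :- :- b := :- (:- b :- a)) refl

        ισ-involution : ∀ t → InV t × ¬ Positive (W t) → (InV (ισ t) × ¬ Positive (W (ισ t))) × ισ (ισ t) ≡ t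
        ισ-involution (x , y , z) ((((s@(solution e py pz) , px) , pa) , pb) , ¬pw) =
            ((((solution (trans (form-ισ x y z) e) pa pb , nonpositive⇒neg-positive (W≢0 x y z s) ¬pw) , transfer (sym (A-ισ x y z)) py)
              , transfer (sym (B-ισ x y z)) pz) , λ pw′ → positive-neg px (transfer (W-ισ x y z) pw′))
          , triple-≡ (trans (cong -_ (W-ισ x y z)) (ℤ.neg-involutive x)) (A-ισ x y z) (B-ισ x y z)

    -- The reflection in the vector (1 , 0 , -1) of norm 1. It interchanges the values of z and U,
    -- and so preserves the conditions z > 0 and U > 0 together.
    σ₂ : Triple → Triple
    σ₂ (x , y , z) = + 2 * y - x , y , U (x , y , z)

    Y-X : Triple → ℤ
    Y-X (x , y , z) = y - x

    U-involution : ∀ t → Solution t × Positive (U t) → (Solution (σ₂ t) × Positive (U (σ₂ t))) × σ₂ (σ₂ t) ≡ t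
    U-involution (x , y , z) (solution e py pz , pu) =
        (solution (trans (form x y z) e) py pu , transfer (sym (U-σ₂ x y z)) pz)
      , triple-≡ (X-σ₂ x y) refl (U-σ₂ x y z)
      where
      form : ∀ x y z → (+ 2 * y - x) * (+ 2 * y - x) + + 2 * (y * U (x , y , z)) ≡ x * x + + 2 * (y * z)
      form = solve 3 (λ x y z → (con (+ 2) :* y :- x) :* (con (+ 2) :* y :- x) :+ con (+ 2) :* (y :* :U x y z)
                             := x :* x :+ con (+ 2) :* (y :* z)) refl

      U-σ₂ : ∀ x y z → U (σ₂ (x , y , z)) ≡ z
      U-σ₂ = solve 3 (λ x y z → :U (con (+ 2) :* y :- x) y (:U x y z) := z) refl

      X-σ₂ : ∀ x y → + 2 * y - (+ 2 * y - x) ≡ x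
      X-σ₂ = solve 2 (λ x y → con (+ 2) :* y :- (con (+ 2) :* y :- x) := x) refl

    swap : Triple → Triple
    swap (x , y , z) = x , z , y

    Z-Y : Triple → ℤ
    Z-Y (x , y , z) = z - y

    swap-involution : ∀ t → Solution t × Positive (X t) → (Solution (swap t) × Positive (X (swap t))) × swap (swap t) ≡ t
    swap-involution (x , y , z) (solution e py pz , px) =
      (solution (trans (cong (λ m → x * x + + 2 * m) (ℤ.*-comm z y)) e) pz py , px) , refl

    positive-suc : ∀ {i} → Positive i → ∃ λ n → i ≡ + suc n
    positive-suc {+ suc n} _ = n , refl
    positive-suc {+ zero} (ℤ.+<+ ())

    Representation : ℕ × ℕ → Set
    Representation (i , j) = squareForm 1 2 (i , j) ≡ N × 1 ≤ i × 1 ≤ j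

    representation-enumeration : Enumeration Representation
    representation-enumeration = record
      { elements = representations 2 N
      ; unique   = Unique.filter⁺ form? (Unique.cartesianProduct⁺ range-unique range-unique)
      ; sound    = λ {ij} h → let ij∈ , e = ∈-filter⁻ form? {xs = pairs} h
                                  i∈ , j∈ = ∈-cartesianProduct⁻ range range ij∈
                              in e , 1≤ (proj₁ ij) i∈ , 1≤ (proj₂ ij) j∈
      ; complete = λ {(i , j)} (e , 1≤i , 1≤j) → ∈-filter⁺ form?
          (∈-cartesianProduct⁺
            (∈-range i 1≤i (ℕ.≤-trans (m≤m*m i) (ℕ.≤-trans (ℕ.m≤n*m (i ℕ.* i) 1) (ℕ.≤-trans (ℕ.m≤m+n _ _) (ℕ.≤-reflexive e)))))
            (∈-range j 1≤j (ℕ.≤-trans (m≤m*m j) (ℕ.≤-trans (ℕ.m≤n*m (j ℕ.* j) 2) (ℕ.≤-trans (ℕ.m≤n+m _ (1 ℕ.* (i ℕ.* i))) (ℕ.≤-reflexive e))))))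
          e
      }
      where
      range : List ℕ
      range = applyUpTo suc N

      pairs : List (ℕ × ℕ)
      pairs = cartesianProduct range range

      form? : Decidable (λ ij → squareForm 1 2 ij ≡ N)
      form? ij = squareForm 1 2 ij ℕ.≟ N

      range-unique : Unique.Unique range
      range-unique = Unique.applyUpTo⁺₁ suc N (λ i<j _ e → ℕ.<-irrefl (ℕ.suc-injective e) i<j)

      1≤ : ∀ i → i ∈ range → 1 ≤ i
      1≤ i h with ∈-applyUpTo⁻ suc h
      ... | _ , _ , refl = s≤s z≤n

      ∈-range : ∀ i → 1 ≤ i → i ≤ N → i ∈ range
      ∈-range (suc i) _ i<N = ∈-applyUpTo⁺ suc i<N

    -- The fixed points y = z of `swap` satisfy x² + 2y² = N, and x > 0 selects one sign of x.
    T-diagonal : card (restrict T-set (λ t → Z-Y t ℤ.≟ 0ℤ)) ≡ length (representations 2 N)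
    T-diagonal = card-bijection (restrict T-set (λ t → Z-Y t ℤ.≟ 0ℤ)) representation-enumeration
      (λ (x , y , z) → ∣ x ∣ , ∣ y ∣) (λ (i , j) → + i , + j , + j) to from
      where
      to : ∀ t → (Solution t × Positive (X t)) × Z-Y t ≡ 0ℤ →
           Representation (∣ proj₁ t ∣ , ∣ proj₁ (proj₂ t) ∣) × (+ ∣ proj₁ t ∣ , + ∣ proj₁ (proj₂ t) ∣ , + ∣ proj₁ (proj₂ t) ∣) ≡ t
      to (x , y , z) ((solution e py pz , px) , δ≡0)
        with positive-suc px | positive-suc py | ℤ.i-j≡0⇒i≡j z y δ≡0
      ... | i , refl | j , refl | refl =
        (ℤ.+-injective (trans (sym (quadratic-abs 2 (+ suc i) (+ suc j))) e) , s≤s z≤n , s≤s z≤n) , refl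

      from : ∀ ij → Representation ij →
             ((Solution (+ proj₁ ij , + proj₂ ij , + proj₂ ij) × Positive (+ proj₁ ij)) × + proj₂ ij - + proj₂ ij ≡ 0ℤ) × ij ≡ ij
      from (i , j) (e , 1≤i , 1≤j) =
        ((solution (trans (quadratic-abs 2 (+ i) (+ j)) (cong +_ e)) (ℤ.+<+ 1≤j) (ℤ.+<+ 1≤j) , ℤ.+<+ 1≤i) , ℤ.i≡j⇒i-j≡0 {+ j} refl) , refl

    odd-factor : ∀ a b → a ℕ.* b ≡ N → a % 2 ≡ 1
    odd-factor a b h with a % 2 in e | m%n<n a 2
    ... | 0 | _ = ⊥-elim (2∤N (subst (2 ∣_) h (∣m⇒∣m*n b (m%n≡0⇒n∣m a 2 e))))
    ... | 1 | _ = refl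
    ... | suc (suc _) | s≤s (s≤s ())

    1+2*half : ∀ a → a % 2 ≡ 1 → a ≡ 1 ℕ.+ a / 2 ℕ.* 2
    1+2*half a h = trans (m≡m%n+[m/n]*n a 2) (cong (ℕ._+ a / 2 ℕ.* 2) h)

    -- At a fixed point x = y of `σ₂` the equation becomes x (x + 2z) = N and U reduces to z.
    -- Conversely both factors of the odd N are odd, so their difference is even.
    U-diagonal : .{{_ : NonZero N}} → card (restrict U-set (λ t → Y-X t ℤ.≟ 0ℤ)) ≡ card (increasingPairs N)
    U-diagonal = card-bijection (restrict U-set (λ t → Y-X t ℤ.≟ 0ℤ)) (increasingPairs N)
      f g to from
      where
      f : Triple → ℕ × ℕ
      f (x , y , z) = ∣ x ∣ , ∣ x + + 2 * z ∣

      g : ℕ × ℕ → Triple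
      -- For odd a and b the difference of the rounded halves is exactly (b - a)/2.
      g (a , b) = + a , + a , + (b / 2 ℕ.∸ a / 2)

      a+2c : ∀ a c → ∣ + a + + 2 * + c ∣ ≡ a ℕ.+ 2 ℕ.* c
      a+2c a c = cong (λ m → ∣ + a + m ∣) (sym (ℤ.pos-* 2 c))

      product : ∀ a c → + a * + a + + 2 * (+ a * + c) ≡ + (a ℕ.* (a ℕ.+ 2 ℕ.* c))
      product a c = trans (solve 2 (λ a c → a :* a :+ con (+ 2) :* (a :* c) := a :* (a :+ con (+ 2) :* c)) refl (+ a) (+ c))
        (trans (cong (λ m → + a * (+ a + m)) (sym (ℤ.pos-* 2 c))) (sym (ℤ.pos-* a (a ℕ.+ 2 ℕ.* c))))

      to : ∀ t → (Solution t × Positive (U t)) × Y-X t ≡ 0ℤ → (FactorPair N (f t) × Positive (difference (f t))) × g (f t) ≡ t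
      to (x , y , z) ((solution e py pz , _) , δ≡0) with positive-suc py | positive-suc pz | ℤ.i-j≡0⇒i≡j y x δ≡0
      ... | a′ , refl | c′ , refl | refl =
          (trans (cong (a ℕ.*_) (a+2c a c)) (ℤ.+-injective (trans (sym (product a c)) e))
          , transfer (sym (trans (cong (λ m → + m - + a) (a+2c a c)) (solve 2 (λ a m → a :+ m :- a := m) refl (+ a) (+ (2 ℕ.* c))))) (ℤ.+<+ (s≤s z≤n)))
        , triple-≡ refl refl (cong +_ (trans (cong (λ b → b / 2 ℕ.∸ a / 2) (a+2c a c)) (begin
            (a ℕ.+ 2 ℕ.* c) / 2 ℕ.∸ a / 2      ≡⟨ cong (ℕ._∸ a / 2) (+-distrib-/-∣ʳ a {2 ℕ.* c} {2} (m∣m*n c)) ⟩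
            a / 2 ℕ.+ 2 ℕ.* c / 2 ℕ.∸ a / 2    ≡⟨ ℕ.m+n∸m≡n (a / 2) _ ⟩
            2 ℕ.* c / 2                        ≡⟨ cong (_/ 2) (ℕ.*-comm 2 c) ⟩
            c ℕ.* 2 / 2                        ≡⟨ m*n/n≡m c 2 ⟩
            c                                  ∎)))
        where
        open ≡.≡-Reasoning
        a c : ℕ
        a = suc a′
        c = suc c′

      from : ∀ ab → FactorPair N ab × Positive (difference ab) → ((Solution (g ab) × Positive (U (g ab))) × Y-X (g ab) ≡ 0ℤ) × f (g ab) ≡ ab
      from (a , b) (h , 0<b-a) =
          ((solution (trans (product a c) (cong +_ (trans (cong (a ℕ.*_) a+2c≡b) h))) (ℤ.+<+ 1≤a) (ℤ.+<+ 1≤c)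
          , transfer (solve 2 (λ a c → c := con (+ 2) :* a :- con (+ 2) :* a :+ c) refl (+ a) (+ c)) (ℤ.+<+ 1≤c))
          , ℤ.i≡j⇒i-j≡0 {+ a} refl)
        , cong (a ,_) (trans (a+2c a c) a+2c≡b)
        where
        c : ℕ
        c = b / 2 ℕ.∸ a / 2

        a<b : a < b
        a<b = ℕ.≰⇒> (λ b≤a → ℤ.<⇒≱ 0<b-a (ℤ.i≤j⇒i-j≤0 (ℤ.+≤+ b≤a)))

        a-odd : a ≡ 1 ℕ.+ a / 2 ℕ.* 2
        a-odd = 1+2*half a (odd-factor a b h)

        b-odd : b ≡ 1 ℕ.+ b / 2 ℕ.* 2
        b-odd = 1+2*half b (odd-factor b a (trans (ℕ.*-comm b a) h))

        half< : a / 2 < b / 2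
        half< = ℕ.*-cancelʳ-< 2 (a / 2) (b / 2) (ℕ.+-cancelˡ-< 1 _ _ (ℕ.≤-trans (ℕ.≤-reflexive (cong suc (sym a-odd))) (ℕ.≤-trans a<b (ℕ.≤-reflexive b-odd))))

        1≤a : 1 ≤ a
        1≤a = ℕ.≤-trans (s≤s z≤n) (ℕ.≤-reflexive (sym a-odd))

        1≤c : 1 ≤ c
        1≤c = ℕ.m<n⇒0<n∸m half<

        a+2c≡b : a ℕ.+ 2 ℕ.* c ≡ b
        a+2c≡b = begin
          a ℕ.+ 2 ℕ.* c                          ≡⟨ cong₂ ℕ._+_ a-odd (ℕ.*-comm 2 c) ⟩
          1 ℕ.+ a / 2 ℕ.* 2 ℕ.+ c ℕ.* 2          ≡⟨ cong suc (ℕ.*-distribʳ-+ 2 (a / 2) c) ⟨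
          1 ℕ.+ (a / 2 ℕ.+ c) ℕ.* 2              ≡⟨ cong (λ m → 1 ℕ.+ m ℕ.* 2) (ℕ.m+[n∸m]≡n (ℕ.<⇒≤ half<)) ⟩
          1 ℕ.+ b / 2 ℕ.* 2                      ≡⟨ b-odd ⟨
          b                                      ∎
          where open ≡.≡-Reasoning

    -- Modulo 2, r(N) is the size of `T-set` by `swap`, which is that of `U-set` as `V-set` is even,
    -- which is the number of increasing factor pairs by `σ₂`.
    even-representations : .{{_ : NonZero N}} → 2 ∣ card (increasingPairs N) → 2 ∣ length (representations 2 N)
    even-representations h = ∣m+n∣m⇒∣n
      (subst (2 ∣_) (trans (sym T≡U+V) (trans T≡ (ℕ.+-comm (length (representations 2 N)) _))) (∣m∣n⇒∣m+n U-even V-even))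
      (m∣m*n (card (restrict T-set (λ t → 0ℤ ℤ.<? Z-Y t))))
      where
      T≡ : card T-set ≡ length (representations 2 N) ℕ.+ 2 ℕ.* card (restrict T-set (λ t → 0ℤ ℤ.<? Z-Y t))
      T≡ = trans (card-involution T-set swap Z-Y swap-involution
          (λ (x , y , z) → solve 2 (λ y z → y :- z := :- (z :- y)) refl y z))
        (cong (ℕ._+ 2 ℕ.* card (restrict T-set (λ t → 0ℤ ℤ.<? Z-Y t))) T-diagonal)

      U-even : 2 ∣ card U-set
      U-even = subst (2 ∣_) (sym (trans (card-involution U-set σ₂ Y-X U-involution
          (λ (x , y , z) → solve 2 (λ x y → y :- (con (+ 2) :* y :- x) := :- (y :- x)) refl x y))
        (cong (ℕ._+ 2 ℕ.* card (restrict U-set (λ t → 0ℤ ℤ.<? Y-X t))) U-diagonal)))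
        (∣m∣n⇒∣m+n h (m∣m*n (card (restrict U-set (λ t → 0ℤ ℤ.<? Y-X t)))))

-- Specialisation to N = p^(2k+1) (4n + 3)

open import Data.Nat using (_+_; _*_; _^_)

module _ (p : ℕ) (prime : Prime p) (p%4≡1 : p % 4 ≡ 1) (n k : ℕ) (p∤M : p ∤ (4 * n + 3)) where

  M N : ℕ
  M = 4 * n + 3
  N = p ^ (2 * k + 1) * M

  M%4≡3 : M % 4 ≡ 3
  M%4≡3 = trans (cong (_% 4) (trans (ℕ.+-comm (4 * n) 3) (cong (ℕ._+_ 3) (ℕ.*-comm 4 n)))) ([m+kn]%n≡m%n 3 n 4)

  p^e%4≡1 : ∀ e → p ^ e % 4 ≡ 1
  p^e%4≡1 zero    = refl
  p^e%4≡1 (suc e) = Residues.*-mod 4 {p} {1} {p ^ e} {1} p%4≡1 (p^e%4≡1 e)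

  level%4≡3 : ∀ e → (p ^ e * M) % 4 ≡ 3
  level%4≡3 e = Residues.*-mod 4 {p ^ e} {1} {M} {3} (p^e%4≡1 e) M%4≡3

  not-square : ∀ e a → a * a ≢ p ^ e * M
  not-square e a h = x²+y²%4≢3 a 0 (trans (cong (_% 4) (trans (ℕ.+-identityʳ _) (trans (ℕ.*-identityˡ (a * a)) h))) (level%4≡3 e))

  N-odd : odd? N ≡ true
  N-odd = cong (_≡ᵇ 1) (trans (sym (m∣n⇒o%n%m≡o%m 2 4 N (divides 2 refl))) (cong (_% 2) (level%4≡3 (2 * k + 1))))

  N-not-two-squares : ∀ i j → squareForm 1 1 (i , j) ≢ N
  N-not-two-squares i j h = x²+y²%4≢3 i j (trans (cong (_% 4) h) (level%4≡3 (2 * k + 1)))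

  instance
    M-nonZero : NonZero M
    M-nonZero = ℕ.>-nonZero (ℕ.≤-trans (s≤s z≤n) (ℕ.m≤n+m 3 (4 * n)))

  open PrimePower p M prime p∤M using (level-nonZero; even-increasingPairs)

  N%8 : N % 8 ≡ 3 ⊎ N % 8 ≡ 7
  N%8 = residue (N % 8) (m%n<n N 8) (trans (m∣n⇒o%n%m≡o%m 4 8 N (divides 2 refl)) (level%4≡3 (2 * k + 1)))
    where
    residue : ∀ r → r < 8 → r % 4 ≡ 3 → r ≡ 3 ⊎ r ≡ 7
    residue 3 _ _ = inj₁ refl
    residue 7 _ _ = inj₂ refl
    residue 0 _ ()
    residue 1 _ ()
    residue 2 _ ()
    residue 4 _ ()
    residue 5 _ ()
    residue 6 _ ()
    residue (suc (suc (suc (suc (suc (suc (suc (suc r)))))))) r<8 _ = ⊥-elim (ℕ.<⇒≱ r<8 (ℕ.m≤m+n 8 r))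

  -- Numbers ≡ 7 (mod 8) can have the form a² - 2b², as 7 = 3² - 2 · 1² shows, so the involution
  -- argument is confined to the class 3; in the class 7 there is nothing to count.
  N-even-representations : 2 ∣ length (representations 2 N)
  N-even-representations with N%8
  ... | inj₁ N%8≡3 = TernaryForm.even-representations N N%8≡3 {{level-nonZero (2 * k + 1)}}
    (even-increasingPairs k (not-square 0) (not-square (2 * k + 1)))
  ... | inj₂ N%8≡7 = subst (λ l → 2 ∣ length l)
    (sym (Coefficients.no-representations N 2 (λ i j h → x²+2y²%8≢7 i j (trans (cong (_% 8) h) N%8≡7)))) (2 ∣0)

  argument : 4 * p ^ (2 * k + 1) * n + 3 * p ^ (2 * k + 1) ≡ N
  argument = ℕ-Solver.solve 2 (λ P n → ℕ-Solver.con 4 ℕ-Solver.:* P ℕ-Solver.:* n ℕ-Solver.:+ ℕ-Solver.con 3 ℕ-Solver.:* P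
    ℕ-Solver.:= P ℕ-Solver.:* (ℕ-Solver.con 4 ℕ-Solver.:* n ℕ-Solver.:+ ℕ-Solver.con 3)) refl (p ^ (2 * k + 1)) n

  -- The exponent is written with `suc m` because one factor 2 is spent on forming O² = 1 + 4κ.
  ā-2^[1+m]*α : ∀ m α → 2 ^ (suc m + 3) ∣ ā (2 ^ suc m * α) (4 * p ^ (2 * k + 1) * n + 3 * p ^ (2 * k + 1))
  ā-2^[1+m]*α m α = ≡.subst₂ (λ e x → 2 ^ e ∣ ā (2 ^ suc m * α) x) (ℕ.+-suc m 3) (sym argument)
    (Coefficients.ā-2^m*α N N-odd N-not-two-squares N-even-representations m α)

  ā-2β+1 : ∀ β → 16 ∣ ā (2 * β + 1) (4 * p ^ (2 * k + 1) * n + 3 * p ^ (2 * k + 1))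
  ā-2β+1 β = subst (λ x → 16 ∣ ā (2 * β + 1) x) (sym argument)
    (Coefficients.ā-odd N N-odd N-not-two-squares N-even-representations β)

theorem1p8 : ∀ (p m α β : ℕ) → Prime p → p % 4 ≡ 1 →
    1 ≤ m → 1 ≤ α → 1 ≤ β → 2 ∤ α →
    (2 ∣ ā (2 ^ m * α) (3 * p) →
    ∀ (n k : ℕ) → p ∤ (4 * n + 3) →
    2 ^ (m + 3) ∣ ā (2 ^ m * α) (4 * p ^ (2 * k + 1) * n + 3 * p ^ (2 * k + 1)))
    ×
    (2 ∣ ā (2 * β + 1) (3 * p) →
    ∀ (n k : ℕ) → p ∤ (4 * n + 3) →
    16 ∣ ā (2 * β + 1) (4 * p ^ (2 * k + 1) * n + 3 * p ^ (2 * k + 1)))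
theorem1p8 p (suc m) α β p-prime p%4≡1 _ _ _ _ =
    (λ _ n k p∤M → ā-2^[1+m]*α p p-prime p%4≡1 n k p∤M m α)
  , (λ _ n k p∤M → ā-2β+1 p p-prime p%4≡1 n k p∤M β)
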